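{- Let $m\ge1$ and let $\zeta_m$ be a primitive $m$th root of unity. The real cyclotomic unit $\zeta_m+\zeta_m^{ -1}$ has arboreal height $\le 2$ only if $m\in\{1,2,3,4,5,6,8,10,12,16,20,24\}$.
   Context: An algebraic integer is totally real if all roots of its minimal polynomial over $\mathbb{Q}$ are real. The eigenvalues of a graph are those of its adjacency matrix; a rooted tree has height $h$ if the maximum distance from the root to a vertex is $h$. The arboreal height of a totally real algebraic integer $\lambda$ is the least $h$ such that some rooted tree of height $h$ has $\lambda$ as an eigenvalue. -}

module Defs where

open import Level using (Level; _⊔_)
open import Data.Nat as ℕ using (ℕ; zero; suc; _<_; _≤_)
open import Data.Fin as Fin using (Fin; zero; suc)
open import Data.Fin.Properties using () renaming (_≟_ to _≟ᶠ_)
open import Data.Bool using (Bool; true; false; _∨_; _∧_; if_then_else_)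
open import Data.Product using (Σ; ∃; _×_; _,_)
open import Relation.Nullary using (¬_)
open import Relation.Nullary.Decidable using (⌊_⌋)
open import Relation.Binary.PropositionalEquality using (_≡_)
open import Data.List using (List; _∷_; [])
open import Algebra.Bundles using (CommutativeRing)

module RingOps {c ℓ} (R : CommutativeRing c ℓ) where
  open CommutativeRing R using (Carrier; 0#; 1#; _+_; _*_)
  nat : ℕ → Carrier
  nat zero    = 0#
  nat (suc k) = 1# + nat k
  infixr 8 _^_
  _^_ : Carrier → ℕ → Carrier
  x ^ zero  = 1#
  x ^ suc k = x * (x ^ k)

record Field₀ (c ℓ : Level) : Set (Level.suc (c ⊔ ℓ)) where
  field
    cring : CommutativeRing c ℓ
  open CommutativeRing cring
  open RingOps cring
  field
    1≉0       : ¬ (1# ≈ 0#)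
    inverse   : ∀ x → ¬ (x ≈ 0#) → ∃ λ y → x * y ≈ 1#
    charZero  : ∀ k → ¬ (nat (ℕ.suc k) ≈ 0#)
  open CommutativeRing cring public
  open RingOps cring public

module _ {c ℓ} (K : Field₀ c ℓ) where
  open Field₀ K using (Carrier; _≈_; 0#; 1#; _+_; _*_; _^_)

  PrimitiveRoot : ℕ → Carrier → Set ℓ
  PrimitiveRoot m ζ = (ζ ^ m ≈ 1#) × (∀ k → 0 < k → k < m → ¬ (ζ ^ k ≈ 1#))

  -- ζ + ζ⁻¹ ; since ζ^m = 1, ζ⁻¹ = ζ^(m-1)
  realCyc : ℕ → Carrier → Carrier
  realCyc m ζ = ζ + ζ ^ (m ℕ.∸ 1)

  ∑ : ∀ {n} → (Fin n → Carrier) → Carrier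
  ∑ {zero}  f = 0#
  ∑ {suc n} f = f zero + ∑ (λ i → f (suc i))

-- Rooted trees on the vertex set Fin (suc n), root = zero.
-- The vertex (suc i) has parent (par i); edges are exactly {suc i , par i}.

record RootedTree (n : ℕ) : Set

module TreeOps {n : ℕ} (par : Fin n → Fin (suc n)) where
  parent : Fin (suc n) → Fin (suc n)
  parent zero    = zero
  parent (suc i) = par i

  up : ℕ → Fin (suc n) → Fin (suc n)
  up zero    v = v
  up (suc k) v = up k (parent v)

  HeightAtMost′ : ℕ → Set
  HeightAtMost′ h = ∀ v → up h v ≡ zero

  adj′ : Fin (suc n) → Fin (suc n) → Bool
  adj′ zero    zero    = false
  adj′ zero    (suc j) = ⌊ par j ≟ᶠ zero ⌋
  adj′ (suc i) zero    = ⌊ par i ≟ᶠ zero ⌋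
  adj′ (suc i) (suc j) = ⌊ par i ≟ᶠ suc j ⌋ ∨ ⌊ par j ≟ᶠ suc i ⌋

record RootedTree n where
  field
    par : Fin n → Fin (suc n)
    -- connectedness / acyclicity: every vertex reaches the root
    reachesRoot : ∃ λ k → TreeOps.HeightAtMost′ par k

adj : ∀ {n} → RootedTree n → Fin (suc n) → Fin (suc n) → Bool
adj T = TreeOps.adj′ (RootedTree.par T)

HeightAtMost : ∀ {n} → RootedTree n → ℕ → Set
HeightAtMost T = TreeOps.HeightAtMost′ (RootedTree.par T)


IsEigenvalue : ∀ {c ℓ} (K : Field₀ c ℓ) {n} → RootedTree n → Field₀.Carrier K → Set (c ⊔ ℓ)
IsEigenvalue K {n} T λ' =
  ∃ λ (x : Fin (suc n) → Carrier) →
    (∃ λ u → ¬ (x u ≈ 0#)) ×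
    (∀ u → ∑ K (λ w → if adj T u w then x w else 0#) ≈ λ' * x u)
  where open Field₀ K using (Carrier; _≈_; 0#; _*_)

allowed : List ℕ
allowed = 1 ∷ 2 ∷ 3 ∷ 4 ∷ 5 ∷ 6 ∷ 8 ∷ 10 ∷ 12 ∷ 16 ∷ 20 ∷ 24 ∷ []

module Submission where

-- Write μ = ζ + ζ⁻¹, η = ζ² and θ = μ² = η + 2 + η⁻¹. In a tree of height 2 whose i-th root child
-- has aᵢ children, the eigenvalue equation becomes 1 = ∑ 1/(θ - aᵢ) unless θ is a natural number.
-- This is impossible 2-adically in R = ℤ[ζ], where 2 is not a unit. Let o be the odd part of m.
-- If o ∉ {1, 3}, then θ and θ - 1 are units modulo 2, so modulo 2 the equation only depends on the
-- parities of the aᵢ and forces θ² + θ + 1 ≡ 0, i.e. η⁵ ≡ 1 (mod 2); then η¹⁰ ≡ 1 (mod 4), and a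
-- root of unity congruent to 1 modulo 4 is 1, so m ∣ 20. If 32 ∣ m and o = 1, respectively 48 ∣ m
-- and o = 3, then τ = θ, respectively τ = θ - 1, is a nonunit with τ⁴ ∣ 2, and the equation
-- multiplied by τ is contradictory modulo τ³. The remaining m are all allowed.

-- The field is arbitrary of characteristic zero: it carries no valuation and its equality need not
-- be decidable. Congruences are therefore explicit equations in `R`, and the only equalities
-- decided are ζᵏ = 1, through divisibility by m. That 2 is not a unit in `R` is a determinant
-- argument: if 1/2 preserved the lattice spanned by the powers of ζ, an integer matrix congruent to
-- the identity modulo 2 would annihilate these powers, although one of them is 1. The inverses 1/(θ
-- - aᵢ) leave `R`, so their sum is tracked as a fraction whose denominator is a unit modulo g, with
-- a residue e₀q₀ + e₁q₁; here q₀ and q₁ belong to even and odd offsets, and only the parities of e₀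
-- and e₁ are kept. The exponents 3 and 4 are tied together. For odd e, τ/(τ - e) is -τ - τ² modulo
-- τ³. An odd number of such terms gives τ ≡ -τ - τ², which is consistent modulo τ² because τ
-- divides 2; modulo τ³ it leaves the contradiction τ² ≡ 0. For even e, τ/(τ - e) ≡ 1 modulo τ³
-- because τ⁴ ∣ 2 makes e/τ a multiple of τ³. The bounds 32 and 48 provide this fourth power.

open import Defs
open import Level using (Level; _⊔_)
open import Algebra.Bundles using (CommutativeRing; RawRing)
open import Algebra.Morphism.Structures using (IsRingMonomorphism)
import Algebra.Morphism.RingMonomorphism as RingMonomorphism
open import Data.Bool using (Bool; true; false; _∨_; if_then_else_)
open import Data.Empty using (⊥; ⊥-elim)
open import Data.Fin as Fin using (Fin; zero; suc; toℕ; fromℕ<)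
open import Data.Fin.Properties using (all?; toℕ-fromℕ<) renaming (_≟_ to _≟ᶠ_)
open import Data.List.Membership.Propositional using (_∈_)
open import Data.Maybe using (Maybe; just; nothing)
open import Data.Nat as ℕ using (ℕ; zero; suc; _≤_; _<_; _≥_; z≤n; s≤s)
open import Data.List.Membership.DecPropositional ℕ._≟_ using (_∈?_)
open import Data.Nat.Divisibility
  using (_∣_; _∣?_; divides; ∣⇒≤; *-cancelˡ-∣; ∣-reflexive; m%n≡0⇒n∣m)
open import Data.Nat.DivMod using (_%_; _/_; m≡m%n+[m/n]*n; m%n<n)
open import Data.Nat.Induction using (<-rec)
import Data.Nat.Properties as ℕₚ
import Data.Nat.Tactic.RingSolver as ℕ-Solver
open import Data.Product using (Σ; ∃; ∃₂; _×_; _,_; proj₁; proj₂)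
open import Data.Sum using (_⊎_; inj₁; inj₂)
open import Relation.Binary.PropositionalEquality as ≡ using (_≡_; _≢_)
open import Relation.Nullary using (¬_; yes; no; Dec)
open import Relation.Nullary.Decidable using (⌊_⌋; toWitness; from-no; _→-dec_)

-- Ring identities with integer coefficients

-- Integers as differences (a , b) ↦ a − b, kept in the normal form where a or b is 0.
Diff : Set
Diff = ℕ × ℕ

norm : ℕ → ℕ → Diff
norm (suc a) (suc b) = norm a b
norm zero    b       = zero , b
norm (suc a) zero    = suc a , zero

diffRing : RawRing _ _
diffRing = record
  { Carrier = Diff
  ; _≈_     = _≡_
  ; _+_     = λ p q → norm (proj₁ p ℕ.+ proj₁ q) (proj₂ p ℕ.+ proj₂ q)
  ; _*_     = λ p q → norm (proj₁ p ℕ.* proj₁ q ℕ.+ proj₂ p ℕ.* proj₂ q)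
                           (proj₁ p ℕ.* proj₂ q ℕ.+ proj₂ p ℕ.* proj₁ q)
  ; -_      = λ p → proj₂ p , proj₁ p
  ; 0#      = 0 , 0
  ; 1#      = 1 , 0
  }

module RingSolver {c ℓ} (R : CommutativeRing c ℓ) where
  open CommutativeRing R hiding (zero)
  open import Algebra.Properties.Ring ring
    using (-0#≈0#; -‿distribˡ-*; -‿distribʳ-*; -‿involutive; -‿+-comm)
  open import Algebra.Properties.Semiring.Mult semiring
    using (×-homo-+; ×1-homo-*) renaming (_×_ to _×ᵣ_)
  open import Algebra.Properties.CommutativeSemigroup +-commutativeSemigroup
    using (interchange)
  open import Algebra.Solver.Ring.AlmostCommutativeRing
    using (fromCommutativeRing; _-Raw-AlmostCommutative⟶_)
  open import Relation.Binary.Reasoning.Setoid setoid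

  natᵣ : ℕ → Carrier
  natᵣ 0             = 0#
  natᵣ 1             = 1#
  natᵣ (suc (suc n)) = 1# + natᵣ (suc n)

  natᵣ≈× : ∀ n → natᵣ n ≈ n ×ᵣ 1#
  natᵣ≈× 0             = refl
  natᵣ≈× 1             = sym (+-identityʳ 1#)
  natᵣ≈× (suc (suc n)) = +-congˡ (natᵣ≈× (suc n))

  diff : ℕ → ℕ → Carrier
  diff a b = a ×ᵣ 1# - b ×ᵣ 1#

  -- Literals (n , 0) evaluate to 1# + (1# + …) without a trailing 0#.
  ⟦_⟧ : Diff → Carrier
  ⟦ a , zero  ⟧ = natᵣ a
  ⟦ a , suc b ⟧ = diff a (suc b)

  ⟦⟧≈diff : ∀ p → ⟦ p ⟧ ≈ diff (proj₁ p) (proj₂ p)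
  ⟦⟧≈diff (a , zero)  = begin
    natᵣ a            ≈⟨ natᵣ≈× a ⟩
    a ×ᵣ 1#           ≈⟨ +-identityʳ _ ⟨
    a ×ᵣ 1# + 0#      ≈⟨ +-congˡ -0#≈0# ⟨
    diff a 0          ∎
  ⟦⟧≈diff (a , suc b) = refl

  interchange-neg : ∀ w x y z → (w + y) - (x + z) ≈ (w - x) + (y - z)
  interchange-neg w x y z = trans (+-congˡ (sym (-‿+-comm x z))) (interchange w y (- x) (- z))

  ⟦norm⟧ : ∀ a b → ⟦ norm a b ⟧ ≈ diff a b
  ⟦norm⟧ (suc a) (suc b) = begin
    ⟦ norm a b ⟧                ≈⟨ ⟦norm⟧ a b ⟩
    diff a b                    ≈⟨ +-identityˡ _ ⟨
    0# + diff a b               ≈⟨ +-congʳ (-‿inverseʳ 1#) ⟨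
    (1# - 1#) + diff a b        ≈⟨ interchange-neg 1# 1# _ _ ⟨
    diff (suc a) (suc b)        ∎
  ⟦norm⟧ zero    b       = ⟦⟧≈diff (zero , b)
  ⟦norm⟧ (suc a) zero    = ⟦⟧≈diff (suc a , zero)

  diff-+ : ∀ a b c d → diff (a ℕ.+ c) (b ℕ.+ d) ≈ diff a b + diff c d
  diff-+ a b c d = trans
    (+-cong (×-homo-+ 1# a c) (-‿cong (×-homo-+ 1# b d)))
    (interchange-neg _ _ _ _)

  -‿*-‿ : ∀ x y → - x * - y ≈ x * y
  -‿*-‿ x y = trans (sym (-‿distribˡ-* x (- y)))
    (trans (-‿cong (sym (-‿distribʳ-* x y))) (-‿involutive _))

  diff-* : ∀ a b c d →
    diff (a ℕ.* c ℕ.+ b ℕ.* d) (a ℕ.* d ℕ.+ b ℕ.* c) ≈ diff a b * diff c d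
  diff-* a b c d = begin
    diff (a ℕ.* c ℕ.+ b ℕ.* d) (a ℕ.* d ℕ.+ b ℕ.* c)
      ≈⟨ diff-+ (a ℕ.* c) (a ℕ.* d) (b ℕ.* d) (b ℕ.* c) ⟩
    diff (a ℕ.* c) (a ℕ.* d) + diff (b ℕ.* d) (b ℕ.* c)
      ≈⟨ +-cong (+-cong (×1-homo-* a c) (-‿cong (×1-homo-* a d)))
                (+-cong (×1-homo-* b d) (-‿cong (×1-homo-* b c))) ⟩
    (A * C - A * D) + (B * D - B * C)
      ≈⟨ +-cong (+-congˡ (-‿distribʳ-* A D))
                (trans (+-comm _ _) (+-cong (-‿distribˡ-* B C) (sym (-‿*-‿ B D)))) ⟩
    (A * C + A * - D) + (- B * C + - B * - D)
      ≈⟨ +-cong (distribˡ A C (- D)) (distribˡ (- B) C (- D)) ⟨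
    A * (C - D) + - B * (C - D)
      ≈⟨ distribʳ (C - D) A (- B) ⟨
    (A - B) * (C - D) ∎
    where
    A = a ×ᵣ 1#
    B = b ×ᵣ 1#
    C = c ×ᵣ 1#
    D = d ×ᵣ 1#

  diff-neg : ∀ a b → diff b a ≈ - diff a b
  diff-neg a b = begin
    B - A          ≈⟨ +-congʳ (-‿involutive B) ⟨
    - - B + - A    ≈⟨ -‿+-comm (- B) A ⟩
    - (- B + A)    ≈⟨ -‿cong (+-comm (- B) A) ⟩
    - (A - B)      ∎
    where
    A = a ×ᵣ 1#
    B = b ×ᵣ 1#

  open RawRing diffRing public using () renaming (_+_ to _+ᵈ_; _*_ to _*ᵈ_; -_ to -ᵈ_)

  ⟦⟧-+ : ∀ p q → ⟦ p +ᵈ q ⟧ ≈ ⟦ p ⟧ + ⟦ q ⟧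
  ⟦⟧-+ p@(a , b) q@(c , d) = trans (⟦norm⟧ (a ℕ.+ c) (b ℕ.+ d))
    (trans (diff-+ a b c d) (+-cong (sym (⟦⟧≈diff p)) (sym (⟦⟧≈diff q))))

  ⟦⟧-* : ∀ p q → ⟦ p *ᵈ q ⟧ ≈ ⟦ p ⟧ * ⟦ q ⟧
  ⟦⟧-* p@(a , b) q@(c , d) = trans (⟦norm⟧ (a ℕ.* c ℕ.+ b ℕ.* d) (a ℕ.* d ℕ.+ b ℕ.* c))
    (trans (diff-* a b c d) (*-cong (sym (⟦⟧≈diff p)) (sym (⟦⟧≈diff q))))

  ⟦⟧-neg : ∀ p → ⟦ -ᵈ p ⟧ ≈ - ⟦ p ⟧
  ⟦⟧-neg p = trans (⟦⟧≈diff (-ᵈ p))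
    (trans (diff-neg (proj₁ p) (proj₂ p)) (-‿cong (sym (⟦⟧≈diff p))))

  morphism : diffRing -Raw-AlmostCommutative⟶ fromCommutativeRing R
  morphism = record
    { ⟦_⟧    = ⟦_⟧
    ; +-homo = ⟦⟧-+
    ; *-homo = ⟦⟧-*
    ; -‿homo = ⟦⟧-neg
    ; 0-homo = refl
    ; 1-homo = refl
    }

  coeff≟ : (p q : Diff) → Maybe (⟦ p ⟧ ≈ ⟦ q ⟧)
  coeff≟ (a , b) (c , d) with a ℕ.≟ c | b ℕ.≟ d
  ... | yes ≡.refl | yes ≡.refl = just refl
  ... | _          | _          = nothing

  open import Algebra.Solver.Ring diffRing (fromCommutativeRing R) morphism coeff≟ public
    using (solve; _:=_; _:+_; _:*_; _:-_; :-_; con; Polynomial)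

  :0 :1 :2 : ∀ {n} → Polynomial n
  :0 = con (0 , 0)
  :1 = con (1 , 0)
  :2 = con (2 , 0)

-- Congruences, parities and geometric sums in commutative rings

module RingLemmas {c ℓ} (R : CommutativeRing c ℓ) where
  open CommutativeRing R hiding (zero)
  open RingSolver R public using (solve; _:=_; _:+_; _:*_; _:-_; :-_; :0; :1; :2)
  open import Algebra.Properties.Group +-group using (∙-cancelʳ)
  open import Algebra.Properties.CommutativeSemiring.Exp commutativeSemiring public
    using (_^_; ^-homo-*; ^-assocʳ; ^-congˡ)
  open import Algebra.Properties.Semiring.Mult semiring public
    using () renaming (_×_ to _×ᵣ_)

  2# : Carrier
  2# = 1# + 1#

  -- a ≈ b is derived from l ≈ r whenever a - b is the multiple k (l - r).
  lin : ∀ {l r a b} k → l ≈ r → a + k * r ≈ b + k * l → a ≈ b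
  lin k h e = ∙-cancelʳ (k * _) _ _ (trans e (+-congˡ (*-congˡ h)))

  lin₂ : ∀ {l₁ r₁ l₂ r₂ a b} k₁ k₂ → l₁ ≈ r₁ → l₂ ≈ r₂ →
         a + k₁ * r₁ + k₂ * r₂ ≈ b + k₁ * l₁ + k₂ * l₂ → a ≈ b
  lin₂ k₁ k₂ h₁ h₂ e = lin k₁ h₁ (lin k₂ h₂ e)

  UnitMod : Carrier → Carrier → Set _
  UnitMod g x = ∃₂ λ u t → x * u ≈ 1# + g * t

  unit-* : ∀ {g x y} → UnitMod g x → UnitMod g y → UnitMod g (x * y)
  unit-* {g} {x} {y} (u , s , xu) (v , t , yv) = u * v , s + t + g * s * t ,
    lin₂ (y * v) (1# + g * s) xu yv
      (solve 7 (λ x y u v s t g →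
        (x :* y) :* (u :* v) :+ y :* v :* (:1 :+ g :* s) :+ (:1 :+ g :* s) :* (:1 :+ g :* t)
        := (:1 :+ g :* (s :+ t :+ g :* s :* t)) :+ y :* v :* (x :* u) :+ (:1 :+ g :* s) :* (y :* v))
        refl x y u v s t g)

  unit-divisor : ∀ {g x y z} → x * y ≈ z → UnitMod g z → UnitMod g x
  unit-divisor {g} {x} {y} {z} xy (u , t , zu) = y * u , t ,
    trans (sym (*-assoc x y u)) (trans (*-congʳ xy) zu)

  unit-shift : ∀ {g x y} k → y ≈ x + g * k → UnitMod g x → UnitMod g y
  unit-shift {g} {x} {y} k h (u , t , xu) = u , t + k * u ,
    lin₂ u 1# h xu (solve 6 (λ x y u t g k →
      y :* u :+ u :* (x :+ g :* k) :+ :1 :* (:1 :+ g :* t)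
      := :1 :+ g :* (t :+ k :* u) :+ u :* y :+ :1 :* (x :* u)) refl x y u t g k)

  -- The quotient by 2 may have more than two elements, so this is a genuine condition: the class of
  -- x modulo 2 is that of an integer.
  Parity : Carrier → Set _
  Parity x = ∃ λ k → x ≈ 2# * k ⊎ x ≈ 1# + 2# * k

  parity-+ : ∀ {x y} → Parity x → Parity y → Parity (x + y)
  parity-+ (k , inj₁ p) (l , inj₁ q) = k + l , inj₁ (trans (+-cong p q)
    (solve 2 (λ k l → :2 :* k :+ :2 :* l := :2 :* (k :+ l)) refl k l))
  parity-+ (k , inj₁ p) (l , inj₂ q) = k + l , inj₂ (trans (+-cong p q)
    (solve 2 (λ k l → :2 :* k :+ (:1 :+ :2 :* l) := :1 :+ :2 :* (k :+ l)) refl k l))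
  parity-+ (k , inj₂ p) (l , inj₁ q) = k + l , inj₂ (trans (+-cong p q)
    (solve 2 (λ k l → (:1 :+ :2 :* k) :+ :2 :* l := :1 :+ :2 :* (k :+ l)) refl k l))
  parity-+ (k , inj₂ p) (l , inj₂ q) = 1# + k + l , inj₁ (trans (+-cong p q)
    (solve 2 (λ k l → (:1 :+ :2 :* k) :+ (:1 :+ :2 :* l) := :2 :* (:1 :+ k :+ l)) refl k l))

  parity-0 : Parity 0#
  parity-0 = 0# , inj₁ (sym (zeroʳ 2#))

  parity-1 : Parity 1#
  parity-1 = 0# , inj₂ (sym (trans (+-congˡ (zeroʳ 2#)) (+-identityʳ 1#)))

  parity-× : ∀ n → Parity (n ×ᵣ 1#)
  parity-× zero    = parity-0
  parity-× (suc n) = parity-+ parity-1 (parity-× n)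

  ×-double : ∀ n → (n ℕ.+ n) ×ᵣ 1# ≈ 2# * (n ×ᵣ 1#)
  ×-double n = trans (×-homo-+ 1# n n) (solve 1 (λ x → x :+ x := :2 :* x) refl _)
    where open import Algebra.Properties.Semiring.Mult semiring using (×-homo-+)

  geom : ℕ → Carrier → Carrier
  geom zero    x = 0#
  geom (suc n) x = 1# + x * geom n x

  geom-telescope : ∀ n x → (1# - x) * geom n x ≈ 1# - x ^ n
  geom-telescope zero    x = solve 1 (λ x → (:1 :- x) :* :0 := :1 :- :1) refl x
  geom-telescope (suc n) x = lin x (geom-telescope n x)
    (solve 3 (λ x g p → (:1 :- x) :* (:1 :+ x :* g) :+ x :* (:1 :- p)
      := (:1 :- x :* p) :+ x :* ((:1 :- x) :* g)) refl x (geom n x) (x ^ n))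

  -- n - (1 + x + ⋯ + xⁿ⁻¹) is the sum of the 1 - xʲ.
  geom-residue : ∀ n x → ∃ λ h → n ×ᵣ 1# ≈ (1# - x) * h + geom n x
  geom-residue zero    x = 0# , solve 1 (λ x → :0 := (:1 :- x) :* :0 :+ :0) refl x
  geom-residue (suc n) x with geom-residue n x
  ... | h , e = h + geom n x , lin 1# e
    (solve 4 (λ x h g m → (:1 :+ m) :+ :1 :* ((:1 :- x) :* h :+ g)
      := ((:1 :- x) :* (h :+ g) :+ (:1 :+ x :* g)) :+ :1 :* m) refl x h (geom n x) (n ×ᵣ 1#))

  unit-square : ∀ {p q} r → p * p ≈ q + 2# * r → UnitMod 2# p → UnitMod 2# q
  unit-square {p} {q} r h up = unit-shift (- r)
    (lin (- 1#) h (solve 3 (λ p q r → q :+ :- :1 :* (q :+ :2 :* r)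
        := (p :* p :+ :2 :* (:- r)) :+ :- :1 :* (p :* p)) refl p q r))
    (unit-* up up)

  ^-2 : ∀ x → x ^ 2 ≈ x * x
  ^-2 x = *-congˡ (*-identityʳ x)

  -- Frobenius: modulo 2, squaring 1 + x gives 1 + x². Together with its analogue for 1 + x + x²,
  -- this carries a hypothetical unit to a power of x where the expression visibly vanishes modulo
  -- 2.
  unit-1+x^ : ∀ n x → UnitMod 2# (1# + x) → UnitMod 2# (1# + x ^ (2 ℕ.^ n))
  unit-1+x^ zero    x u = unit-shift 0#
    (solve 1 (λ x → :1 :+ x :* :1 := :1 :+ x :+ :2 :* :0) refl x) u
  unit-1+x^ (suc n) x u = unit-shift 0#
    (trans (+-congˡ (sym (^-assocʳ x 2 (2 ℕ.^ n)))) (solve 1 (λ y → :1 :+ y := :1 :+ y :+ :2 :* :0) refl _))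
    (unit-1+x^ n (x ^ 2) (unit-square x
      (solve 1 (λ x → (:1 :+ x) :* (:1 :+ x) := (:1 :+ x :* (x :* :1)) :+ :2 :* x) refl x) u))

  unit-1+x+x²^ : ∀ n x → UnitMod 2# (1# + x + x * x) →
    UnitMod 2# (1# + x ^ (2 ℕ.^ n) + x ^ (2 ℕ.^ n) * x ^ (2 ℕ.^ n))
  unit-1+x+x²^ zero    x u = unit-shift 0#
    (solve 1 (λ x → :1 :+ x :* :1 :+ (x :* :1) :* (x :* :1) := :1 :+ x :+ x :* x :+ :2 :* :0) refl x) u
  unit-1+x+x²^ (suc n) x u = unit-shift 0#
    (trans (+-cong (+-congˡ e) (*-cong e e))
      (solve 1 (λ y → :1 :+ y :+ y :* y := :1 :+ y :+ y :* y :+ :2 :* :0) refl _))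
    (unit-1+x+x²^ n (x ^ 2) (unit-square (x + x * x + x * x * x)
      (solve 1 (λ x → (:1 :+ x :+ x :* x) :* (:1 :+ x :+ x :* x)
         := (:1 :+ x :* (x :* :1) :+ (x :* (x :* :1)) :* (x :* (x :* :1))) :+ :2 :* (x :+ x :* x
             :+ x :* x :* x)) refl x) u))
    where
    e : x ^ (2 ℕ.^ suc n) ≈ (x ^ 2) ^ (2 ℕ.^ n)
    e = sym (^-assocʳ x 2 (2 ℕ.^ n))

  unit-1-x : ∀ n x → UnitMod 2# (1# - x ^ n) → UnitMod 2# (1# - x)
  unit-1-x n x = unit-divisor (geom-telescope n x)

  -- 1 + x = (1 - x) + 2x gains a factor 1 - x once 1 - x divides 2.
  ramify² : ∀ x {w} → (1# - x) * w ≈ 2# → ∃ λ r → 1# - x * x ≈ ((1# - x) * (1# - x)) * r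
  ramify² x {w} h = 1# + w * x , lin ((1# - x) * x) (sym h)
    (solve 2 (λ x w → (:1 :- x :* x) :+ ((:1 :- x) :* x) :* ((:1 :- x) :* w)
      := ((:1 :- x) :* (:1 :- x)) :* (:1 :+ w :* x) :+ ((:1 :- x) :* x) :* :2) refl x w)

  -- Both 1 - x and 1 - x² divide 1 - x⁴, hence 2. So `ramify²` applies at x² and at x, and 1 - x⁴ =
  -- (1 - x²)²r = (1 - x)⁴r′²r.
  ramify⁴ : ∀ x {z} → (1# - (x * x) * (x * x)) * z ≈ 2# →
    ∃ λ s → ((1# - x) * (1# - x)) * ((1# - x) * (1# - x)) * s ≈ 2#
  ramify⁴ x {z} h = r′ * r′ * r * z , (begin
    b⁴ * (r′ * r′ * r * z)           ≈⟨ regroup b r r′ z ⟩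
    (b² * r′) * (b² * r′) * r * z    ≈⟨ *-congʳ (*-congʳ (*-cong q q)) ⟨
    e * e * r * z                    ≈⟨ *-congʳ p ⟨
    (1# - (x * x) * (x * x)) * z     ≈⟨ h ⟩
    2#                               ∎)
    where
    open import Relation.Binary.Reasoning.Setoid setoid
    b  = 1# - x
    b² = b * b
    b⁴ = b² * b²
    e  = 1# - x * x
    regroup : ∀ b r r′ z → (b * b) * (b * b) * (r′ * r′ * r * z) ≈ (b * b * r′) * (b * b * r′) * r * z
    regroup = solve 4 (λ b r r′ z → (b :* b) :* (b :* b) :* (r′ :* r′ :* r :* z)
      := (b :* b :* r′) :* (b :* b :* r′) :* r :* z) refl
    r-p : ∃ λ r → 1# - (x * x) * (x * x) ≈ (e * e) * r
    r-p = ramify² (x * x) (trans (factor x z) h)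
      where
      factor : ∀ x z → (1# - x * x) * ((1# + x * x) * z) ≈ (1# - (x * x) * (x * x)) * z
      factor = solve 2 (λ x z → (:1 :- x :* x) :* ((:1 :+ x :* x) :* z) := (:1 :- (x :* x) :* (x :* x)) :* z) refl
    r = proj₁ r-p
    p = proj₂ r-p
    r′-q : ∃ λ r′ → e ≈ b² * r′
    r′-q = ramify² x (trans (factor x z) h)
      where
      factor : ∀ x z → (1# - x) * ((1# + x) * (1# + x * x) * z) ≈ (1# - (x * x) * (x * x)) * z
      factor = solve 2 (λ x z → (:1 :- x) :* ((:1 :+ x) :* (:1 :+ x :* x) :* z)
        := (:1 :- (x :* x) :* (x :* x)) :* z) refl
    r′ = proj₁ r′-q
    q = proj₂ r′-q

-- Domains in which 2 is neither zero nor a unit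

record DyadicDomain {c ℓ} (R : CommutativeRing c ℓ) : Set (c ⊔ ℓ) where
  open CommutativeRing R
  open RingLemmas R using (2#)
  field
    integral : ∀ {x y} → x * y ≈ 0# → ¬ (x ≈ 0#) → y ≈ 0#
    2≉0      : ¬ (2# ≈ 0#)
    2∤1      : ∀ x → ¬ (2# * x ≈ 1#)

module DyadicLemmas {c ℓ} (R : CommutativeRing c ℓ) (domain : DyadicDomain R) where
  open CommutativeRing R
  open RingLemmas R
  open DyadicDomain domain

  -- The geometric sum 1 + x + ⋯ + xⁿ⁻¹ vanishes for a root of unity x ≠ 1, so `geom-residue` leaves
  -- the odd number n as a multiple of 1 - x.
  odd-unit : ∀ {x} k → x ^ suc (k ℕ.+ k) ≈ 1# → ¬ (x ≈ 1#) → ∃ λ h → (1# - x) * h ≈ 1# + 2# * (k ×ᵣ 1#)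
  odd-unit {x} k xⁿ x≉1 = h , (begin
    (1# - x) * h             ≈⟨ +-identityʳ _ ⟨
    (1# - x) * h + 0#        ≈⟨ +-congˡ geom≈0 ⟨
    (1# - x) * h + geom n x  ≈⟨ proj₂ (geom-residue n x) ⟨
    n ×ᵣ 1#                  ≈⟨ +-congˡ (×-double k) ⟩
    1# + 2# * (k ×ᵣ 1#)      ∎)
    where
    open import Relation.Binary.Reasoning.Setoid setoid
    n = suc (k ℕ.+ k)
    h = proj₁ (geom-residue n x)
    geom≈0 : geom n x ≈ 0#
    geom≈0 = integral {1# - x}
      (trans (geom-telescope n x) (trans (+-congˡ (-‿cong xⁿ)) (-‿inverseʳ 1#)))
      (λ z → x≉1 (lin (- 1#) z (solve 1 (λ x → x :+ :- :1 :* :0 := :1 :+ :- :1 :* (:1 :- x)) refl x)))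

  0-nonunit : ¬ UnitMod 2# 0#
  0-nonunit (u , t , h) = 2∤1 (- t) (lin 1# h
    (solve 2 (λ u t → :2 :* (:- t) :+ :1 :* (:1 :+ :2 :* t) := :1 :+ :1 :* (:0 :* u)) refl u t))

  square-root-of-1 : ∀ {x} → x * x ≈ 1# → ¬ (x ≈ 1#) → x + 1# ≈ 0#
  square-root-of-1 {x} xx x≉1 = integral {x - 1#}
    (lin 1# xx (solve 1 (λ x → (x :- :1) :* (x :+ :1) :+ :1 :* :1 := :0 :+ :1 :* (x :* x)) refl x))
    (λ z → x≉1 (lin 1# z (solve 1 (λ x → x :+ :1 :* :0 := :1 :+ :1 :* (x :- :1)) refl x)))

  OneMod4 : Carrier → Set _
  OneMod4 x = ∃ λ t → x ≈ 1# + 2# * 2# * t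

  oneMod4-^ : ∀ n {x} → OneMod4 x → OneMod4 (x ^ n)
  oneMod4-^ n {x} (t , h) = t * geom n x , lin₂ 1# (geom n x) (geom-telescope n x) h
    (solve 4 (λ x t g p → p :+ :1 :* (:1 :- p) :+ g :* (:1 :+ :2 :* :2 :* t)
      := (:1 :+ :2 :* :2 :* (t :* g)) :+ :1 :* ((:1 :- x) :* g) :+ g :* x) refl x t (geom n x) (x ^ n))

  -- Otherwise x = -1, and 2 + 4t = 0 makes 2 a unit after cancelling a factor 2. The decision is a
  -- hypothesis because the ring does not supply one.
  oneMod4-square : ∀ {x} → OneMod4 x → x * x ≈ 1# → Dec (x ≈ 1#) → x ≈ 1#
  oneMod4-square     m       xx (yes x≈1) = x≈1
  oneMod4-square {x} (t , h) xx (no x≉1)  = ⊥-elim (2∤1 (- t) (lin 1# 1+2t≈0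
    (solve 1 (λ t → :2 :* (:- t) :+ :1 :* :0 := :1 :+ :1 :* (:- :1 :- :2 :* t) ) refl t)))
    where
    1+2t≈0 : - 1# - 2# * t ≈ 0#
    1+2t≈0 = integral {2#} (lin₂ (- 1#) 1# (square-root-of-1 xx x≉1) h
      (solve 2 (λ x t → :2 :* (:- :1 :- :2 :* t) :+ :- :1 :* :0 :+ :1 :* (:1 :+ :2 :* :2 :* t)
        := :0 :+ :- :1 :* (x :+ :1) :+ :1 :* x) refl x t)) 2≉0

  -- If x ≠ 1, the odd number 2k + 1 is a multiple of 1 - x = -4t, so 2 divides 1.
  oneMod4-odd : ∀ k {x} → OneMod4 x → x ^ suc (k ℕ.+ k) ≈ 1# → Dec (x ≈ 1#) → x ≈ 1#
  oneMod4-odd k     m       xⁿ (yes x≈1) = x≈1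
  oneMod4-odd k {x} (t , e) xⁿ (no x≉1)  = ⊥-elim (2∤1 (- (2# * t * h) - k ×ᵣ 1#)
    (lin₂ 1# h (proj₂ (odd-unit k xⁿ x≉1)) e
      (solve 4 (λ x t h k → :2 :* (:- (:2 :* t :* h) :- k) :+ :1 :* (:1 :+ :2 :* k) :+ h :* (:1 :+ :2 :* :2 :* t)
        := :1 :+ :1 :* ((:1 :- x) :* h) :+ h :* x) refl x t h (k ×ᵣ 1#))))
    where
    h = proj₁ (odd-unit k xⁿ x≉1)

  unit-1-root : ∀ k {x} → x ^ suc (k ℕ.+ k) ≈ 1# → ¬ (x ≈ 1#) → UnitMod 2# (1# - x)
  unit-1-root k xⁿ x≉1 = proj₁ (odd-unit k xⁿ x≉1) , k ×ᵣ 1# , proj₂ (odd-unit k xⁿ x≉1)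

  -- `u` and `v` stand for 1/θ and 1/(θ - 1) modulo 2. The parity patterns read 1 ≡ 0, 1 ≡ 1/θ, 1 ≡
  -- 1/(θ - 1) and 1 ≡ 1/θ + 1/(θ - 1). The second would make the unit θ - 1 vanish modulo 2, the
  -- third the unit θ; clearing denominators in the last gives the quadratic.
  unramified-fractions : ∀ {θ e₀ e₁ t} ((u , _) : UnitMod 2# θ) ((v , _) : UnitMod 2# (θ - 1#)) →
    Parity e₀ → Parity e₁ → 1# ≈ (e₀ * u + e₁ * v) + 2# * t → ∃ λ r → θ * θ + θ + 1# ≈ 2# * r
  unramified-fractions {θ} {e₀} {e₁} {t} (u , a , θu) (v , b , θv) (k , inj₁ p) (l , inj₁ q) h =
    ⊥-elim (2∤1 (k * u + l * v + t) (sym (trans h (trans (+-congʳ (+-cong (*-congʳ p) (*-congʳ q)))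
      (solve 5 (λ k l u v t → (:2 :* k :* u :+ :2 :* l :* v) :+ :2 :* t
          := :2 :* (k :* u :+ l :* v :+ t)) refl k l u v t)))))
  unramified-fractions {θ} {e₀} {e₁} {t} (u , a , θu) (v , b , θv) (k , inj₂ p) (l , inj₁ q) h =
    ⊥-elim (2∤1 (r * v - b) (lin₂ (- v) 1# θ-1≈2r θv
      (solve 4 (λ θ v r b → :2 :* (r :* v :- b) :+ (:- v) :* (:2 :* r) :+ :1 :* (:1 :+ :2 :* b)
        := :1 :+ (:- v) :* (θ :- :1) :+ :1 :* ((θ :- :1) :* v)) refl θ v r b)))
    where
    r = k + a + 2# * k * a + l * v * θ + t * θ
    θ-1≈2r : θ - 1# ≈ 2# * r
    θ-1≈2r = lin₂ θ (1# + 2# * k) (trans h (+-congʳ (+-cong (*-congʳ p) (*-congʳ q)))) θu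
      (solve 7 (λ θ k l u v t a → (θ :- :1) :+ θ :* ((:1 :+ :2 :* k) :* u :+ :2 :* l :* v :+ :2 :* t) :+ (:1
          :+ :2 :* k) :* (:1 :+ :2 :* a)
        := :2 :* (k :+ a :+ :2 :* k :* a :+ l :* v :* θ :+ t :* θ) :+ θ :* :1 :+ (:1 :+ :2 :* k) :* (θ :* u))
            refl θ k l u v t a)
  unramified-fractions {θ} {e₀} {e₁} {t} (u , a , θu) (v , b , θv) (k , inj₁ p) (l , inj₂ q) h =
    ⊥-elim (2∤1 (r * u - a) (lin₂ (- u) 1# θ≈2r θu
      (solve 4 (λ θ u r a → :2 :* (r :* u :- a) :+ (:- u) :* (:2 :* r) :+ :1 :* (:1 :+ :2 :* a)
        := :1 :+ (:- u) :* θ :+ :1 :* (θ :* u)) refl θ u r a)))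
    where
    r = 1# + l + b + 2# * l * b + k * u * (θ - 1#) + t * (θ - 1#)
    θ≈2r : θ ≈ 2# * r
    θ≈2r = lin₂ (θ - 1#) (1# + 2# * l) (trans h (+-congʳ (+-cong (*-congʳ p) (*-congʳ q)))) θv
      (solve 7 (λ θ k l u v t b → θ :+ (θ :- :1) :* (:2 :* k :* u :+ (:1 :+ :2 :* l) :* v :+ :2 :* t) :+ (:1
          :+ :2 :* l) :* (:1 :+ :2 :* b)
        := :2 :* (:1 :+ l :+ b :+ :2 :* l :* b :+ k :* u :* (θ :- :1) :+ t :* (θ :- :1)) :+ (θ :- :1) :* :1
            :+ (:1 :+ :2 :* l) :* ((θ :- :1) :* v)) refl θ k l u v t b)
  unramified-fractions {θ} {e₀} {e₁} {t} (u , a , θu) (v , b , θv) (k , inj₂ p) (l , inj₂ q) h = r ,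
    lin (θ * (θ - 1#)) (trans h (+-congʳ (+-cong (*-congʳ p) (*-congʳ q))))
      (lin₂ ((θ - 1#) * (1# + 2# * k)) (θ * (1# + 2# * l)) θu θv
      (solve 8 (λ θ k l u v t a b →
        (θ :* θ :+ θ :+ :1) :+ θ :* (θ :- :1) :* ((:1 :+ :2 :* k) :* u :+ (:1 :+ :2 :* l) :* v :+ :2 :* t)
          :+ (θ :- :1) :* (:1 :+ :2 :* k) :* (:1 :+ :2 :* a) :+ θ :* (:1 :+ :2 :* l) :* (:1 :+ :2 :* b)
        := :2 :* (:2 :* θ :+ (θ :- :1) :* (a :+ k :+ :2 :* k :* a) :+ θ :* (b :+ l :+ :2 :* l :* b)
            :+ θ :* (θ :- :1) :* t)
          :+ θ :* (θ :- :1) :* :1 :+ (θ :- :1) :* (:1 :+ :2 :* k) :* (θ :* u) :+ θ :* (:1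
              :+ :2 :* l) :* ((θ :- :1) :* v)) refl θ k l u v t a b))
    where
    r = 2# * θ + (θ - 1#) * (a + k + 2# * k * a) + θ * (b + l + 2# * l * b) + θ * (θ - 1#) * t

  -- An odd e₀ makes 1 a multiple of τ. For even e₀ the congruence becomes τ ≡ 0 modulo τ³ when e₁
  -- is even and τ² ≡ 0 when e₁ is odd; cancelling powers of τ again makes τ a unit.
  ramified-fractions : ∀ {τ s e₀ e₁ t} → (τ * τ) * (τ * τ) * s ≈ 2# → (∀ x → ¬ (τ * x ≈ 1#)) →
    Parity e₀ → Parity e₁ → τ ≈ (e₀ * 1# + e₁ * (- (τ + τ * τ))) + τ * τ * τ * t → ⊥
  ramified-fractions {τ} {s} {e₀} {e₁} {t} 2≈ nonunit = go
    where
    τ≉0 : ¬ (τ ≈ 0#)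
    τ≉0 τ≈0 = 2≉0 (lin₂ (- 1#) (τ * τ * τ * s) 2≈ τ≈0
      (solve 2 (λ τ s → :2 :+ :- :1 :* :2 :+ τ :* τ :* τ :* s :* :0
        := :0 :+ :- :1 :* ((τ :* τ) :* (τ :* τ) :* s) :+ τ :* τ :* τ :* s :* τ) refl τ s))

    no-multiple : ∀ x → ¬ (τ * (1# - τ * x) ≈ 0#)
    no-multiple x h = nonunit x (lin (- 1#) (integral h τ≉0)
      (solve 2 (λ τ x → τ :* x :+ :- :1 :* :0 := :1 :+ :- :1 :* (:1 :- τ :* x)) refl τ x))

    go : Parity e₀ → Parity e₁ → τ ≈ (e₀ * 1# + e₁ * (- (τ + τ * τ))) + τ * τ * τ * t → ⊥
    go (k , inj₂ p) _ h = nonunit (1# - k * (τ * τ * τ * s) + e₁ * (1# + τ) - τ * τ * t)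
      (lin₂ 1# (- k) (trans h (+-congʳ (+-congʳ (*-congʳ p)))) 2≈
        (solve 5 (λ τ s e t k →
          τ :* (:1 :- k :* (τ :* τ :* τ :* s) :+ e :* (:1 :+ τ) :- τ :* τ :* t)
            :+ :1 :* ((:1 :+ :2 :* k) :* :1 :+ e :* (:- (τ :+ τ :* τ)) :+ τ :* τ :* τ :* t) :+ (:- k) :* :2
          := :1 :+ :1 :* τ :+ (:- k) :* ((τ :* τ) :* (τ :* τ) :* s)) refl τ s e₁ t k))
    go (k , inj₁ p) (l , inj₁ q) h = no-multiple (τ * τ * s * k - τ * τ * s * l * (τ + τ * τ) + τ * t)
      (lin₂ 1# (- (k - l * (τ + τ * τ))) (trans h (+-congʳ (+-cong (*-congʳ p) (*-congʳ q)))) 2≈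
        (solve 5 (λ τ s l t k →
          τ :* (:1 :- τ :* (τ :* τ :* s :* k :- τ :* τ :* s :* l :* (τ :+ τ :* τ) :+ τ :* t))
            :+ :1 :* (:2 :* k :* :1 :+ :2 :* l :* (:- (τ :+ τ :* τ)) :+ τ :* τ :* τ :* t) :+ (:- (k :- l :* (τ
                :+ τ :* τ))) :* :2
          := :0 :+ :1 :* τ :+ (:- (k :- l :* (τ :+ τ :* τ))) :* ((τ :* τ) :* (τ :* τ) :* s)) refl τ s l t k))
    -- Moving -τ to the left creates 2τ, a multiple of τ⁵. What remains is τ²(1 - τx) = 0, so one
    -- factor τ is cancelled before `no-multiple` applies.
    go (k , inj₁ p) (l , inj₂ q) h = no-multiple (τ * s * k - τ * s * l * (τ + τ * τ) + t - τ * τ * s)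
      (integral {τ} (lin₂ 1# (τ - (k - l * (τ + τ * τ))) (trans h (+-congʳ (+-cong (*-congʳ p) (*-congʳ q)))) 2≈
        (solve 5 (λ τ s l t k →
          τ :* (τ :* (:1 :- τ :* (τ :* s :* k :- τ :* s :* l :* (τ :+ τ :* τ) :+ t :- τ :* τ :* s)))
            :+ :1 :* (:2 :* k :* :1 :+ (:1 :+ :2 :* l) :* (:- (τ :+ τ :* τ)) :+ τ :* τ :* τ :* t)
                :+ (τ :- (k :- l :* (τ :+ τ :* τ))) :* :2
          := :0 :+ :1 :* τ :+ (τ :- (k :- l :* (τ :+ τ :* τ))) :* ((τ :* τ) :* (τ :* τ) :* s)) refl τ s l t k)) τ≉0)

-- Odd parts and the finite list of allowed orders

even⊎odd : ∀ n → ∃ λ k → n ≡ k ℕ.+ k ⊎ n ≡ suc (k ℕ.+ k)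
even⊎odd zero    = 0 , inj₁ ≡.refl
even⊎odd (suc n) with even⊎odd n
... | k , inj₁ p = k , inj₂ (≡.cong suc p)
... | k , inj₂ p = suc k , inj₁ (≡.cong suc (≡.trans p (≡.sym (ℕₚ.+-suc k k))))

odd-part : ∀ n → 1 ≤ n → ∃₂ λ a k → n ≡ 2 ℕ.^ a ℕ.* suc (k ℕ.+ k)
odd-part = <-rec _ step
  where
  step : ∀ n → (∀ {l} → l < n → 1 ≤ l → ∃₂ λ a k → l ≡ 2 ℕ.^ a ℕ.* suc (k ℕ.+ k)) →
         1 ≤ n → ∃₂ λ a k → n ≡ 2 ℕ.^ a ℕ.* suc (k ℕ.+ k)
  step n rec n≥1 with even⊎odd n
  ... | k     , inj₂ p = 0 , k , ≡.trans p (≡.sym (ℕₚ.+-identityʳ _))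
  ... | zero  , inj₁ p = ⊥-elim (ℕₚ.<⇒≢ n≥1 (≡.sym p))
  ... | suc l , inj₁ p with rec (≡.subst (suc l <_) (≡.sym p) (s≤s (ℕₚ.m<m+n l (s≤s z≤n)))) (s≤s z≤n)
  ...   | a , k , q = suc a , k , ≡.trans p (≡.trans (≡.cong₂ ℕ._+_ q q) (double (2 ℕ.^ a) (suc (k ℕ.+ k))))
    where
    double : ∀ x y → x ℕ.* y ℕ.+ x ℕ.* y ≡ (2 ℕ.* x) ℕ.* y
    double = ℕ-Solver.solve-∀

∣20⇒allowed : ∀ {m} → m ∣ 20 → m ∈ allowed
∣20⇒allowed {m} d = ≡.subst (λ l → l ∣ 20 → l ∈ allowed) (toℕ-fromℕ< (s≤s (∣⇒≤ d)))
  (check (fromℕ< (s≤s (∣⇒≤ d)))) d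
  where
  check : (i : Fin 21) → toℕ i ∣ 20 → toℕ i ∈ allowed
  check = toWitness {a? = all? λ i → (toℕ i ∣? 20) →-dec (toℕ i ∈? allowed)} _

2^∈allowed : ∀ a → a ≤ 4 → 2 ℕ.^ a ℕ.* 1 ∈ allowed
2^∈allowed a a≤4 = ≡.subst (λ l → 2 ℕ.^ l ℕ.* 1 ∈ allowed) (toℕ-fromℕ< (s≤s a≤4)) (check (fromℕ< (s≤s a≤4)))
  where
  check : (i : Fin 5) → 2 ℕ.^ toℕ i ℕ.* 1 ∈ allowed
  check = toWitness {a? = all? λ i → (2 ℕ.^ toℕ i ℕ.* 1) ∈? allowed} _

2^*3∈allowed : ∀ a → a ≤ 3 → 2 ℕ.^ a ℕ.* 3 ∈ allowed
2^*3∈allowed a a≤3 = ≡.subst (λ l → 2 ℕ.^ l ℕ.* 3 ∈ allowed) (toℕ-fromℕ< (s≤s a≤3)) (check (fromℕ< (s≤s a≤3)))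
  where
  check : (i : Fin 4) → 2 ℕ.^ toℕ i ℕ.* 3 ∈ allowed
  check = toWitness {a? = all? λ i → (2 ℕ.^ toℕ i ℕ.* 3) ∈? allowed} _

-- Roots of unity modulo 2: the case distinction on m

record RootOfUnity {c ℓ} (R : CommutativeRing c ℓ) (m : ℕ) : Set (c ⊔ ℓ) where
  open CommutativeRing R
  open RingLemmas R using (_^_)
  field
    ζ ζ⁻¹ : Carrier
    ζζ⁻¹  : ζ * ζ⁻¹ ≈ 1#
    ^≈1⇒∣ : ∀ k → ζ ^ k ≈ 1# → m ∣ k
    ∣⇒^≈1 : ∀ {k} → m ∣ k → ζ ^ k ≈ 1#

module Classification {c ℓ} (R : CommutativeRing c ℓ) (domain : DyadicDomain R)
  (m : ℕ) (root : RootOfUnity R m) where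
  open CommutativeRing R
  open RingLemmas R
  open DyadicDomain domain
  open DyadicLemmas R domain
  open RootOfUnity root
  open import Relation.Binary.Reasoning.Setoid setoid

  θ η : Carrier
  θ = (ζ + ζ⁻¹) * (ζ + ζ⁻¹)
  η = ζ * ζ

  -- What each case hands to the tree argument. The two alternatives for τ serve the odd parts 1 and
  -- 3; the last component of `Unramified` finishes its case once the eigenvalue equation has
  -- yielded the quadratic.
  Ramified Unramified : Set _
  Ramified = ∃₂ λ τ s → (τ * τ) * (τ * τ) * s ≈ 2# × (∀ x → ¬ (τ * x ≈ 1#)) × (τ ≈ θ ⊎ 1# + τ ≈ θ)
  Unramified = UnitMod 2# θ × UnitMod 2# (θ - 1#) × ((∃ λ r → θ * θ + θ + 1# ≈ 2# * r) → m ∣ 20)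

  -- Equality in the ring is not decidable in general, but for a primitive root this instance
  -- amounts to m ∣ k.
  ζ^?1 : ∀ k → Dec (ζ ^ k ≈ 1#)
  ζ^?1 k with m ∣? k
  ... | yes d = yes (∣⇒^≈1 d)
  ... | no ¬d = no λ e → ¬d (^≈1⇒∣ k e)

  ^-square : ∀ x k → x ^ (k ℕ.+ k) ≈ x ^ k * x ^ k
  ^-square x k = ^-homo-* x k k

  η≈ζ² : η ≈ ζ ^ 2
  η≈ζ² = sym (^-2 ζ)

  η^ : ∀ k → η ^ k ≈ ζ ^ (2 ℕ.* k)
  η^ k = trans (^-congˡ k η≈ζ²) (^-assocʳ ζ 2 k)

  θη : θ * η ≈ (1# + η) * (1# + η)
  θη = lin₂ (ζ * ζ⁻¹ + 1# + 2# * η) 0# ζζ⁻¹ ζζ⁻¹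
    (solve 2 (λ z z′ → ((z :+ z′) :* (z :+ z′)) :* (z :* z) :+ (z :* z′ :+ :1 :+ :2 :* (z :* z)) :* :1 :+ :0 :* :1
      := (:1 :+ z :* z) :* (:1 :+ z :* z) :+ (z :* z′ :+ :1 :+ :2 :* (z :* z)) :* (z :* z′)
          :+ :0 :* (z :* z′)) refl ζ ζ⁻¹)

  [θ-1]η : (θ - 1#) * η ≈ 1# + η + η * η
  [θ-1]η = lin 1# θη (solve 2 (λ t e → (t :- :1) :* e :+ :1 :* ((:1 :+ e) :* (:1 :+ e))
    := (:1 :+ e :+ e :* e) :+ :1 :* (t :* e)) refl θ η)

  inverse-unit : ∀ {g x y} → x * y ≈ 1# → UnitMod g x
  inverse-unit {g} {x} {y} h = y , 0# , trans h (sym (trans (+-congˡ (zeroʳ g)) (+-identityʳ 1#)))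

  η-unit : ∀ {g} → UnitMod g η
  η-unit = inverse-unit {y = ζ⁻¹ * ζ⁻¹} (lin₂ (1# + ζ * ζ⁻¹) 0# ζζ⁻¹ ζζ⁻¹
    (solve 2 (λ z z′ → z :* z :* (z′ :* z′) :+ (:1 :+ z :* z′) :* :1 :+ :0 :* :1
      := :1 :+ (:1 :+ z :* z′) :* (z :* z′) :+ :0 :* (z :* z′)) refl ζ ζ⁻¹))

  -1-power : ∀ k → m ≡ k ℕ.+ k → 1 ≤ k → ζ ^ k + 1# ≈ 0#
  -1-power k m≡ k≥1 = square-root-of-1
    (trans (sym (^-square ζ k)) (∣⇒^≈1 (∣-reflexive m≡)))
    (λ e → ℕₚ.<⇒≱ (≡.subst (k <_) (≡.sym m≡) (ℕₚ.m<m+n k k≥1))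
             (∣⇒≤ {{ℕ.>-nonZero k≥1}} (^≈1⇒∣ k e)))

  -- Here η to the power jn is ζ to the power m/2, that is -1; so 1 - ηʲ divides 1 - (-1) = 2.
  1-η∣2 : ∀ j n → m ≡ 2 ℕ.* (j ℕ.* n) ℕ.+ 2 ℕ.* (j ℕ.* n) → 1 ≤ 2 ℕ.* (j ℕ.* n) →
    ∃ λ z → (1# - η ^ j) * z ≈ 2#
  1-η∣2 j n m≡ pos = geom n (η ^ j) , lin₂ 1# (- 1#)
    (trans (geom-telescope n (η ^ j)) (+-congˡ (-‿cong (trans (^-assocʳ η j n) (η^ (j ℕ.* n))))))
    (-1-power _ m≡ pos)
    (solve 2 (λ a y → a :+ :1 :* (:1 :- y) :+ :- :1 :* :0
      := :2 :+ :1 :* a :+ :- :1 :* (y :+ :1)) refl _ _)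

  -- Up to the unit η, θ is (1 + η)², which divides 1 - η² by `ramify²` at -η. The fourth power of 1
  -- - η² divides 2 by `ramify⁴` at η², provided 1 - η⁸ divides 2. Since η to the power m/4 is -1,
  -- this holds when 8 divides m/4, whence the bound 32.
  θ-ramified : ∀ b → m ≡ 2 ℕ.^ (5 ℕ.+ b) ℕ.* 1 → Ramified
  θ-ramified b m≡ = θ , (η * η) * (η * η) * ((r * r) * (r * r) * s) , divides-2 , nonunit , inj₁ refl
    where
    N = 2 ℕ.^ b
    arith : ∀ x → 2 ℕ.* (2 ℕ.* (2 ℕ.* (2 ℕ.* (2 ℕ.* x)))) ℕ.* 1 ≡ 2 ℕ.* (8 ℕ.* x) ℕ.+ 2 ℕ.* (8 ℕ.* x)
    arith = ℕ-Solver.solve-∀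
    η⁸∣2 : ∃ λ z → (1# - η ^ 8) * z ≈ 2#
    η⁸∣2 = 1-η∣2 8 N (≡.trans m≡ (arith N)) (ℕₚ.*-mono-≤ {1} {2} (s≤s z≤n) (ℕₚ.*-mono-≤ {1} {8} (s≤s z≤n)
        (ℕₚ.m^n>0 2 b)))
    B = 1# - η * η
    r4 : ∃ λ s → (B * B) * (B * B) * s ≈ 2#
    r4 = ramify⁴ (η * η) (trans (solve 2 (λ e z → (:1 :- ((e :* e) :* (e :* e)) :* ((e :* e) :* (e :* e))) :* z
        := (:1 :- e :* (e :* (e :* (e :* (e :* (e :* (e :* (e :* :1)))))))) :* z) refl η _) (proj₂ η⁸∣2))
    s = proj₁ r4
    r2 : ∃ λ r → 1# - (- η) * (- η) ≈ ((1# - - η) * (1# - - η)) * r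
    r2 = ramify² (- η) (trans (solve 2 (λ e s →
        (:1 :- (:- e)) :* ((:1 :- e) :* (:1 :- e :* e) :* ((:1 :- e :* e) :* (:1 :- e :* e)) :* s)
        := ((:1 :- e :* e) :* (:1 :- e :* e)) :* ((:1 :- e :* e) :* (:1 :- e :* e)) :* s) refl η s) (proj₂ r4))
    r = proj₁ r2
    B≈ : (θ * η) * r ≈ B
    B≈ = begin
      (θ * η) * r                          ≈⟨ *-congʳ θη ⟩
      ((1# + η) * (1# + η)) * r            ≈⟨ solve 2 (λ e r → ((:1 :+ e) :* (:1 :+ e)) :* r
          := ((:1 :- :- e) :* (:1 :- :- e)) :* r) refl η r ⟩
      ((1# - - η) * (1# - - η)) * r        ≈⟨ proj₂ r2 ⟨
      1# - (- η) * (- η)                   ≈⟨ solve 1 (λ e → :1 :- (:- e) :* (:- e) := :1 :- e :* e) refl η ⟩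
      B                                    ∎
    divides-2 : (θ * θ) * (θ * θ) * ((η * η) * (η * η) * ((r * r) * (r * r) * s)) ≈ 2#
    divides-2 = begin
      (θ * θ) * (θ * θ) * ((η * η) * (η * η) * ((r * r) * (r * r) * s))
        ≈⟨ solve 4 (λ t e r s → (t :* t) :* (t :* t) :* ((e :* e) :* (e :* e) :* ((r :* r) :* (r :* r) :* s))
             := ((t :* e :* r) :* (t :* e :* r)) :* ((t :* e :* r) :* (t :* e :* r)) :* s) refl θ η r s ⟩
      ((θ * η * r) * (θ * η * r)) * ((θ * η * r) * (θ * η * r)) * s
        ≈⟨ *-congʳ (*-cong (*-cong B≈ B≈) (*-cong B≈ B≈)) ⟩
      (B * B) * (B * B) * s  ≈⟨ proj₂ r4 ⟩
      2# ∎
    -- If θ were a unit, so would be 1 + η, and by Frobenius 1 + η ^ M modulo 2 as well; but `M`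
    -- equals m, so η ^ M = 1 and the sum is 2.
    nonunit : ∀ x → ¬ (θ * x ≈ 1#)
    nonunit x θx = 0-nonunit (unit-shift (- 1#) 0≈ (unit-1+x^ (5 ℕ.+ b) η unit-1+η))
      where
      unit-1+η : UnitMod 2# (1# + η)
      unit-1+η = unit-divisor (sym θη) (unit-* (inverse-unit θx) η-unit)
      M = 2 ℕ.^ (5 ℕ.+ b)
      m∣2M : m ∣ 2 ℕ.* M
      m∣2M = divides 2 (≡.cong (2 ℕ.*_) (≡.trans (≡.sym (ℕₚ.*-identityʳ M)) (≡.sym m≡)))
      0≈ : 0# ≈ 1# + η ^ M + 2# * (- 1#)
      0≈ = sym (trans (+-congʳ (+-congˡ (trans (η^ M) (∣⇒^≈1 m∣2M))))
        (solve 0 (:1 :+ :1 :+ :2 :* :- :1 := :0) refl))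

  -- Since (θ - 1)η = 1 + η + η², τ divides 1 - η³. `ramify⁴` at η³ needs 1 - η¹² to divide 2, hence
  -- 12 to divide m/4: the bound 48.
  θ-1-ramified : ∀ b → m ≡ 2 ℕ.^ (4 ℕ.+ b) ℕ.* 3 → Ramified
  θ-1-ramified b m≡ = τ , (A * A) * (A * A) * s , divides-2 , nonunit ,
    inj₂ (solve 1 (λ t → :1 :+ (t :- :1) := t) refl θ)
    where
    τ = θ - 1#
    N = 2 ℕ.^ b
    A = η * (1# - η)
    B = 1# - η * η * η
    arith : ∀ x → 2 ℕ.* (2 ℕ.* (2 ℕ.* (2 ℕ.* x))) ℕ.* 3 ≡ 2 ℕ.* (12 ℕ.* x) ℕ.+ 2 ℕ.* (12 ℕ.* x)
    arith = ℕ-Solver.solve-∀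
    η¹²∣2 : ∃ λ z → (1# - η ^ 12) * z ≈ 2#
    η¹²∣2 = 1-η∣2 12 N (≡.trans m≡ (arith N)) (ℕₚ.*-mono-≤ {1} {2} (s≤s z≤n) (ℕₚ.*-mono-≤ {1} {12} (s≤s z≤n)
        (ℕₚ.m^n>0 2 b)))
    r4 : ∃ λ s → (B * B) * (B * B) * s ≈ 2#
    r4 = ramify⁴ (η * η * η) (trans (solve 2 (λ e z →
        (:1 :- ((e :* e :* e) :* (e :* e :* e)) :* ((e :* e :* e) :* (e :* e :* e))) :* z
        := (:1 :- e :* (e :* (e :* (e :* (e :* (e :* (e :* (e :* (e :* (e :* (e :* (e :* :1)))))))))))) :* z)
            refl η _) (proj₂ η¹²∣2))
    s = proj₁ r4
    τA≈B : τ * A ≈ B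
    τA≈B = lin (1# - η) [θ-1]η (solve 2 (λ t e → (t :- :1) :* (e :* (:1 :- e)) :+ (:1 :- e) :* (:1 :+ e :+ e :* e)
      := (:1 :- e :* e :* e) :+ (:1 :- e) :* ((t :- :1) :* e)) refl θ η)
    divides-2 : (τ * τ) * (τ * τ) * ((A * A) * (A * A) * s) ≈ 2#
    divides-2 = begin
      (τ * τ) * (τ * τ) * ((A * A) * (A * A) * s)
        ≈⟨ solve 3 (λ t a s → (t :* t) :* (t :* t) :* ((a :* a) :* (a :* a) :* s)
             := ((t :* a) :* (t :* a)) :* ((t :* a) :* (t :* a)) :* s) refl τ A s ⟩
      ((τ * A) * (τ * A)) * ((τ * A) * (τ * A)) * s
        ≈⟨ *-congʳ (*-cong (*-cong τA≈B τA≈B) (*-cong τA≈B τA≈B)) ⟩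
      (B * B) * (B * B) * s  ≈⟨ proj₂ r4 ⟩
      2# ∎
    -- Frobenius moves the unit 1 + η + η² to 1 + ε + ε², where ε is a cube root of unity other than
    -- 1, so this sum is 0.
    nonunit : ∀ x → ¬ (τ * x ≈ 1#)
    nonunit x τx = 0-nonunit (unit-shift 0# 0≈ (unit-1+x+x²^ (4 ℕ.+ b) η
      (unit-shift 0# (trans (sym [θ-1]η) (sym
          (trans (+-congˡ (zeroʳ 2#)) (+-identityʳ _)))) (unit-* (inverse-unit τx) η-unit))))
      where
      M = 2 ℕ.^ (4 ℕ.+ b)
      ε = η ^ M
      ε≉1 : ¬ (ε ≈ 1#)
      ε≉1 e = ℕₚ.<⇒≱ {2} {3} (s≤s (s≤s (s≤s z≤n))) (∣⇒≤ {2} {3} (*-cancelˡ-∣ M {{ℕₚ.m^n≢0 2 (4 ℕ.+ b)}}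
        (≡.subst₂ _∣_ m≡ (ℕₚ.*-comm 2 M) (^≈1⇒∣ (2 ℕ.* M) (trans (sym (η^ M)) e)))))
      ε³ : ε * (ε * (ε * 1#)) ≈ 1#
      ε³ = trans (^-assocʳ η M 3) (trans (η^ (M ℕ.* 3)) (∣⇒^≈1 (divides 2 (≡.cong (2 ℕ.*_) (≡.sym m≡)))))
      0≈ : 0# ≈ 1# + ε + ε * ε + 2# * 0#
      0≈ = sym (trans (solve 1 (λ e → :1 :+ e :+ e :* e :+ :2 :* :0 := :1 :+ e :+ e :* e) refl ε)
        (integral {1# - ε}
          (lin (- 1#) ε³ (solve 1 (λ e → (:1 :- e) :* (:1 :+ e :+ e :* e) :+ :- :1 :* :1
            := :0 :+ :- :1 :* (e :* (e :* (e :* :1)))) refl ε))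
          (λ z → ε≉1 (lin (- 1#) z (solve 1 (λ x → x :+ :- :1 :* :0 := :1 :+ :- :1 :* (:1 :- x)) refl ε)))))

  -- For o ∤ 2j, 1 - ηʲ divides 1 - ε, where ε, its `M`-th power in place of ηʲ, is an odd-order
  -- root of unity other than 1; so 1 - ηʲ is a unit modulo 2. The case j = 1 gives 1 + η ≡ 1 - η
  -- and thereby θ. The case j = 3 gives θ - 1, because (θ - 1)η divides 1 - η³; here o ∤ 6 excludes
  -- the odd part 3.
  unramified : ∀ a k → 2 ≤ k → m ≡ 2 ℕ.^ a ℕ.* suc (k ℕ.+ k) → Unramified
  unramified a k k≥2 m≡ = θ-unit , θ-1-unit , λ (r , h) → m∣20 r h
    where
    M = 2 ℕ.^ a
    o = suc (k ℕ.+ k)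
    5≤o : 5 ≤ o
    5≤o = s≤s (ℕₚ.+-mono-≤ k≥2 k≥2)
    o∤2 : ¬ (o ∣ 2)
    o∤2 d = ℕₚ.<⇒≱ (ℕₚ.≤-trans (s≤s (s≤s (s≤s z≤n))) 5≤o) (∣⇒≤ d)
    5∤6 : ¬ (5 ∣ 6)
    5∤6 = from-no (5 ∣? 6)
    o∤6 : ∀ k → 2 ≤ k → ¬ (suc (k ℕ.+ k) ∣ 6)
    o∤6 (suc zero)          (s≤s ())
    o∤6 (suc (suc zero))    _ d = 5∤6 d
    o∤6 (suc (suc (suc k))) _ d = ℕₚ.<⇒≱ (s≤s
        (ℕₚ.+-mono-≤ {3} {_} {3} (s≤s (s≤s (s≤s z≤n))) (s≤s (s≤s (s≤s z≤n))))) (∣⇒≤ d)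
    o∣ : ∀ j → (η ^ j) ^ M ≈ 1# → o ∣ 2 ℕ.* j
    o∣ j e = *-cancelˡ-∣ M {{ℕₚ.m^n≢0 2 a}} (≡.subst₂ _∣_ m≡ (arith j M)
      (^≈1⇒∣ (2 ℕ.* (j ℕ.* M)) (trans (sym (trans (^-assocʳ η j M) (η^ (j ℕ.* M)))) e)))
      where
      arith : ∀ j x → 2 ℕ.* (j ℕ.* x) ≡ x ℕ.* (2 ℕ.* j)
      arith = ℕ-Solver.solve-∀
    ηʲ-root : ∀ j → ((η ^ j) ^ M) ^ o ≈ 1#
    ηʲ-root j = trans (^-assocʳ (η ^ j) M o) (trans (^-assocʳ η j (M ℕ.* o)) (trans (η^ (j ℕ.* (M ℕ.* o)))
      (∣⇒^≈1 (divides (2 ℕ.* j) (≡.trans (≡.sym (ℕₚ.*-assoc 2 j (M ℕ.* o))) (≡.cong (2 ℕ.* j ℕ.*_) (≡.sym m≡)))))))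
    unit-1-ηʲ : ∀ j → ¬ (o ∣ 2 ℕ.* j) → UnitMod 2# (1# - η ^ j)
    unit-1-ηʲ j o∤ = unit-1-x M (η ^ j) (unit-1-root k (ηʲ-root j) (λ e → o∤ (o∣ j e)))
    unit-1-η : UnitMod 2# (1# - η)
    unit-1-η = unit-1-x 1 η (unit-1-ηʲ 1 o∤2)
    unit-1+η : UnitMod 2# (1# + η)
    unit-1+η = unit-shift η (solve 1 (λ e → :1 :+ e := (:1 :- e) :+ :2 :* e) refl η) unit-1-η
    θ-unit : UnitMod 2# θ
    θ-unit = unit-divisor θη (unit-* unit-1+η unit-1+η)
    θ-1-unit : UnitMod 2# (θ - 1#)
    θ-1-unit = unit-divisor [θ-1]η (unit-divisor {y = 1# - η}
      (solve 1 (λ e → (:1 :+ e :+ e :* e) :* (:1 :- e) := :1 :- e :* (e :* (e :* :1))) refl η)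
      (unit-1-ηʲ 3 (o∤6 k k≥2)))
    m∣20 : ∀ r → θ * θ + θ + 1# ≈ 2# * r → m ∣ 20
    m∣20 r h = ^≈1⇒∣ 20 (oneMod4-odd k ζ²⁰ (descend a all-power) (ζ^?1 20))
      where
      -- η²(θ² + θ + 1) ≡ 1 + η + η² + η³ + η⁴ modulo 2.
      s = (η - 1#) * (η * η * r - 2# * η - 2# * 2# * η * η - 2# * η * η * η)
      η⁵ : η ^ 5 ≈ 1# + 2# * s
      η⁵ = lin₂ ((η - 1#) * (η * η)) (- ((η - 1#) * (θ * η + (1# + η) * (1# + η) + η))) h θη
        (solve 3 (λ t e r →
          e :* (e :* (e :* (e :* (e :* :1)))) :+ (e :- :1) :* (e :* e) :* (:2 :* r)
            :+ (:- ((e :- :1) :* (t :* e :+ (:1 :+ e) :* (:1 :+ e) :+ e))) :* ((:1 :+ e) :* (:1 :+ e))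
          := :1 :+ :2 :* ((e :- :1) :* (e :* e :* r :- :2 :* e :- :2 :* :2 :* e :* e :- :2 :* e :* e :* e))
            :+ (e :- :1) :* (e :* e) :* (t :* t :+ t :+ :1)
            :+ (:- ((e :- :1) :* (t :* e :+ (:1 :+ e) :* (:1 :+ e) :+ e))) :* (t :* e)) refl θ η r)
      ζ²⁰ : OneMod4 (ζ ^ 20)
      ζ²⁰ = s + s * s , (begin
        ζ ^ 20                           ≈⟨ η^ 10 ⟨
        η ^ 10                           ≈⟨ ^-square η 5 ⟩
        η ^ 5 * η ^ 5                    ≈⟨ *-cong η⁵ η⁵ ⟩
        (1# + 2# * s) * (1# + 2# * s)    ≈⟨ solve 1 (λ s → (:1 :+ :2 :* s) :* (:1 :+ :2 :* s)
                                              := :1 :+ :2 :* :2 :* (s :+ s :* s)) refl s ⟩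
        1# + 2# * 2# * (s + s * s)       ∎)
      all-power : ζ ^ (20 ℕ.* (2 ℕ.^ a ℕ.* o)) ≈ 1#
      all-power = ∣⇒^≈1 (divides 20 (≡.cong (20 ℕ.*_) (≡.sym m≡)))
      double : ∀ x y → 20 ℕ.* (2 ℕ.* x ℕ.* y) ≡ 20 ℕ.* (x ℕ.* y) ℕ.+ 20 ℕ.* (x ℕ.* y)
      double = ℕ-Solver.solve-∀
      -- Every power of ζ²⁰ is 1 modulo 4, so factors 2 of its order are stripped one at a time
      -- until only the odd exponent `o` is left.
      descend : ∀ b → ζ ^ (20 ℕ.* (2 ℕ.^ b ℕ.* o)) ≈ 1# → (ζ ^ 20) ^ o ≈ 1#
      descend zero    e = trans (^-assocʳ ζ 20 o)
        (trans (reflexive (≡.cong (λ n → ζ ^ (20 ℕ.* n)) (≡.sym (ℕₚ.*-identityˡ o)))) e)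
      descend (suc b) e = descend b (oneMod4-square
        (let (t , h) = oneMod4-^ (2 ℕ.^ b ℕ.* o) ζ²⁰ in t , trans (sym (^-assocʳ ζ 20 (2 ℕ.^ b ℕ.* o))) h)
        (trans (sym (^-square ζ K)) (trans (reflexive (≡.cong (ζ ^_) (≡.sym (double (2 ℕ.^ b) o)))) e))
        (ζ^?1 K))
        where K = 20 ℕ.* (2 ℕ.^ b ℕ.* o)

  classify : 1 ≤ m → m ∈ allowed ⊎ Ramified ⊎ Unramified
  classify m≥1 with odd-part m m≥1
  ... | a , suc (suc k) , m≡ = inj₂ (inj₂ (unramified a (suc (suc k)) (s≤s (s≤s z≤n)) m≡))
  ... | a , zero , m≡ with ℕₚ.≤-<-connex a 4
  ...   | inj₁ a≤4 = inj₁ (≡.subst (_∈ allowed) (≡.sym m≡) (2^∈allowed a a≤4))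
  ...   | inj₂ 5≤a = inj₂ (inj₁ (θ-ramified (a ℕ.∸ 5)
            (≡.trans m≡ (≡.cong (λ n → 2 ℕ.^ n ℕ.* 1) (≡.sym (ℕₚ.m+[n∸m]≡n 5≤a))))))
  classify m≥1 | a , suc zero , m≡ with ℕₚ.≤-<-connex a 3
  ...   | inj₁ a≤3 = inj₁ (≡.subst (_∈ allowed) (≡.sym m≡) (2^*3∈allowed a a≤3))
  ...   | inj₂ 4≤a = inj₂ (inj₁ (θ-1-ramified (a ℕ.∸ 4)
            (≡.trans m≡ (≡.cong (λ n → 2 ℕ.^ n ℕ.* 3) (≡.sym (ℕₚ.m+[n∸m]≡n 4≤a))))))

-- Subrings and stabilisers of finitely generated lattices

record IsSubring {c ℓ p} (A : CommutativeRing c ℓ) (S : CommutativeRing.Carrier A → Set p) : Set (c ⊔ p) where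
  open CommutativeRing A
  field
    S-+   : ∀ {x y} → S x → S y → S (x + y)
    S-*   : ∀ {x y} → S x → S y → S (x * y)
    S-neg : ∀ {x} → S x → S (- x)
    S-0   : S 0#
    S-1   : S 1#

module Subring {c ℓ p} (A : CommutativeRing c ℓ) (S : CommutativeRing.Carrier A → Set p)
  (isSubring : IsSubring A S) where
  open CommutativeRing A
  open IsSubring isSubring

  -- Equality ignores the membership proofs, so the inclusion is injective by construction and the
  -- ring laws can be pulled back along it.
  rawSubring : RawRing _ _
  rawSubring = record
    { Carrier = Σ Carrier S
    ; _≈_     = λ x y → proj₁ x ≈ proj₁ y
    ; _+_     = λ (x , p) (y , q) → x + y , S-+ p q
    ; _*_     = λ (x , p) (y , q) → x * y , S-* p q
    ; -_      = λ (x , p) → - x , S-neg p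
    ; 0#      = 0# , S-0
    ; 1#      = 1# , S-1
    }

  inclusion : IsRingMonomorphism rawSubring rawRing proj₁
  inclusion = record
    { isRingHomomorphism = record
      { isSemiringHomomorphism = record
        { isNearSemiringHomomorphism = record
          { +-isMonoidHomomorphism = record
            { isMagmaHomomorphism = record
              { isRelHomomorphism = record { cong = λ e → e }
              ; homo = λ _ _ → refl
              }
            ; ε-homo = refl
            }
          ; *-homo = λ _ _ → refl
          }
        ; 1#-homo = refl
        }
      ; -‿homo = λ _ → refl
      }
    ; injective = λ e → e
    }

  subring : CommutativeRing _ _
  subring = record { isCommutativeRing = RingMonomorphism.isCommutativeRing inclusion isCommutativeRing }

module FieldLemmas {c ℓ} (K : Field₀ c ℓ) where
  open Field₀ K using (cring; inverse; charZero; 1≉0)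
  open CommutativeRing cring hiding (zero)
  open RingLemmas cring
  open RingSolver cring using (⟦_⟧; ⟦⟧≈diff; ⟦⟧-+; ⟦⟧-*; ⟦⟧-neg; _+ᵈ_; _*ᵈ_; -ᵈ_)
  open import Relation.Binary.Reasoning.Setoid setoid
  open import Algebra.Properties.Semiring.Sum semiring
    using (sum; sum-cong-≋; *-distribˡ-sum; ∑-distrib-+; sum-replicate-zero)

  integral : ∀ {x y} → x * y ≈ 0# → ¬ (x ≈ 0#) → y ≈ 0#
  integral {x} {y} xy x≉0 with inverse x x≉0
  ... | z , xz = lin₂ (- y) z xz xy (solve 3 (λ x y z → y :+ (:- y) :* :1 :+ z :* :0
    := :0 :+ (:- y) :* (x :* z) :+ z :* (x :* y)) refl x y z)

  nat≡× : ∀ n → Field₀.nat K n ≡ n ×ᵣ 1#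
  nat≡× zero    = ≡.refl
  nat≡× (suc n) = ≡.cong (1# +_) (nat≡× n)

  ×-charZero : ∀ n → ¬ (suc n ×ᵣ 1# ≈ 0#)
  ×-charZero n h = charZero n (trans (reflexive (nat≡× (suc n))) h)

  ×-injective : ∀ m n → m ×ᵣ 1# ≈ n ×ᵣ 1# → m ≡ n
  ×-injective zero    zero    h = ≡.refl
  ×-injective zero    (suc n) h = ⊥-elim (×-charZero n (sym h))
  ×-injective (suc m) zero    h = ⊥-elim (×-charZero m h)
  ×-injective (suc m) (suc n) h = ≡.cong suc (×-injective m n (lin 1# h
    (solve 2 (λ x y → x :+ :1 :* (:1 :+ y) := y :+ :1 :* (:1 :+ x)) refl _ _)))

  2≉0 : ¬ (2# ≈ 0#)
  2≉0 h = ×-charZero 1 (trans (+-congˡ (+-identityʳ 1#)) h)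

  Int : Carrier → Set _
  Int x = ∃ λ d → x ≈ ⟦ d ⟧

  int-+ : ∀ {x y} → Int x → Int y → Int (x + y)
  int-+ (d , p) (e , q) = d +ᵈ e , trans (+-cong p q) (sym (⟦⟧-+ d e))

  int-* : ∀ {x y} → Int x → Int y → Int (x * y)
  int-* (d , p) (e , q) = d *ᵈ e , trans (*-cong p q) (sym (⟦⟧-* d e))

  int-neg : ∀ {x} → Int x → Int (- x)
  int-neg (d , p) = -ᵈ d , trans (-‿cong p) (sym (⟦⟧-neg d))

  int-0 : Int 0#
  int-0 = (0 , 0) , refl

  int-1 : Int 1#
  int-1 = (1 , 0) , refl

  odd≉0 : ∀ {f} → Int f → ¬ (1# + 2# * f ≈ 0#)
  odd≉0 {f} ((a , b) , p) h = ℕₚ.even≢odd b a (≡.sym (×-injective (suc (2 ℕ.* a)) (2 ℕ.* b) (begin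
    suc (2 ℕ.* a) ×ᵣ 1#     ≈⟨ +-congˡ (double a) ⟩
    1# + 2# * (a ×ᵣ 1#)     ≈⟨ lin₂ 1# (- 2#) h (trans p (⟦⟧≈diff (a , b)))
      (solve 3 (λ a b f → (:1 :+ :2 :* a) :+ :1 :* :0 :+ (:- :2) :* (a :- b)
        := :2 :* b :+ :1 :* (:1 :+ :2 :* f) :+ (:- :2) :* f) refl (a ×ᵣ 1#) (b ×ᵣ 1#) f) ⟩
    2# * (b ×ᵣ 1#)          ≈⟨ double b ⟨
    (2 ℕ.* b) ×ᵣ 1#         ∎)))
    where
    double : ∀ n → (2 ℕ.* n) ×ᵣ 1# ≈ 2# * (n ×ᵣ 1#)
    double n = trans (reflexive (≡.cong (λ x → (n ℕ.+ x) ×ᵣ 1#) (ℕₚ.+-identityʳ n))) (×-double n)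

  -- Gaussian elimination: odd pivots stay odd and even off-pivot entries stay even.
  elimination : ∀ {n} (v e : Fin n → Carrier) (C : Fin n → Fin n → Carrier) →
    (∀ i → Int (e i)) → (∀ i j → Int (C i j)) →
    (∀ i → (1# + 2# * e i) * v i ≈ 2# * sum (λ j → C i j * v j)) → ∀ i → v i ≈ 0#
  elimination {zero}  v e C int-e int-C eqs ()
  elimination {suc n} v e C int-e int-C eqs = vanish
    where
    f = e zero - C zero zero
    int-f : Int f
    int-f = int-+ (int-e zero) (int-neg (int-C zero zero))
    T : Fin (suc n) → Carrier
    T i = sum (λ j → C i (suc j) * v (suc j))
    pivot : (1# + 2# * f) * v zero ≈ 2# * T zero
    pivot = lin 1# (eqs zero) (solve 4 (λ e c v t → (:1 :+ :2 :* (e :- c)) :* v :+ :1 :* (:2 :* (c :* v :+ t))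
      := :2 :* t :+ :1 :* ((:1 :+ :2 :* e) :* v)) refl (e zero) (C zero zero) (v zero) (T zero))
    -- The elimination is fraction-free: a row is multiplied by the pivot 1 + 2f, and (1 + 2f)v₀ is
    -- replaced by 2T₀. All coefficients stay integers.
    C′ : Fin n → Fin n → Carrier
    C′ i j = 2# * C (suc i) zero * C zero (suc j) + (1# + 2# * f) * C (suc i) (suc j)
    combine : ∀ i → sum (λ j → C′ i j * v (suc j)) ≈ 2# * C (suc i) zero * T zero + (1# + 2# * f) * T (suc i)
    combine i = begin
      sum (λ j → C′ i j * v (suc j))
        ≈⟨ sum-cong-≋ (λ j → solve 5 (λ a x b y v → (a :* x :+ b :* y) :* v
            := a :* (x :* v) :+ b :* (y :* v)) refl a (C zero (suc j)) b (C (suc i) (suc j)) (v (suc j))) ⟩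
      sum (λ j → a * (C zero (suc j) * v (suc j)) + b * (C (suc i) (suc j) * v (suc j)))
        ≈⟨ ∑-distrib-+ (λ j → a * (C zero (suc j) * v (suc j))) (λ j → b * (C (suc i) (suc j) * v (suc j))) ⟩
      sum (λ j → a * (C zero (suc j) * v (suc j))) + sum (λ j → b * (C (suc i) (suc j) * v (suc j)))
        ≈⟨ +-cong (*-distribˡ-sum a (λ j → C zero (suc j) * v (suc j))) (*-distribˡ-sum b
            (λ j → C (suc i) (suc j) * v (suc j))) ⟨
      a * T zero + b * T (suc i) ∎
      where
      a = 2# * C (suc i) zero
      b = 1# + 2# * f
    e′ : Fin n → Carrier
    e′ i = e (suc i) + f + 2# * e (suc i) * f
    int-2 = int-+ int-1 int-1
    vanish-suc : ∀ i → v (suc i) ≈ 0#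
    vanish-suc = elimination (λ i → v (suc i)) e′ C′
      (λ i → int-+ (int-+ (int-e (suc i)) int-f) (int-* (int-* int-2 (int-e (suc i))) int-f))
      (λ i j → int-+ (int-* (int-* int-2 (int-C (suc i) zero)) (int-C zero (suc j)))
                     (int-* (int-+ int-1 (int-* int-2 int-f)) (int-C (suc i) (suc j))))
      (λ i → trans (lin₂ (1# + 2# * f) (2# * C (suc i) zero) (eqs (suc i)) pivot
        (solve 7 (λ e f w c v t t₀ →
           (:1 :+ :2 :* (e :+ f :+ :2 :* e :* f)) :* w :+ (:1 :+ :2 :* f) :* (:2 :* (c :* v :+ t))
               :+ (:2 :* c) :* (:2 :* t₀)
           := :2 :* (:2 :* c :* t₀ :+ (:1 :+ :2 :* f) :* t) :+ (:1 :+ :2 :* f) :* ((:1 :+ :2 :* e) :* w)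
               :+ (:2 :* c) :* ((:1 :+ :2 :* f) :* v))
           refl (e (suc i)) f (v (suc i)) (C (suc i) zero) (v zero) (T (suc i)) (T zero)))
        (*-congˡ (sym (combine i))))
    vanish : ∀ i → v i ≈ 0#
    vanish (suc i) = vanish-suc i
    vanish zero    = integral (trans pivot (trans (*-congˡ
      (trans (sum-cong-≋ (λ j → trans (*-congˡ (vanish-suc j)) (zeroʳ (C zero (suc j))))) (sum-replicate-zero n)))
      (zeroʳ 2#))) (odd≉0 int-f)

  module Span {n} (v : Fin n → Carrier) where

    Span : Carrier → Set _
    Span x = ∃ λ (a : Fin n → Carrier) → (∀ i → Int (a i)) × x ≈ sum (λ i → a i * v i)

    span-≈ : ∀ {x y} → x ≈ y → Span x → Span y
    span-≈ e (a , int-a , h) = a , int-a , trans (sym e) h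

    span-0 : Span 0#
    span-0 = (λ _ → 0#) , (λ _ → int-0) ,
      sym (trans (sum-cong-≋ {n} (λ i → zeroˡ (v i))) (sum-replicate-zero n))

    span-+ : ∀ {x y} → Span x → Span y → Span (x + y)
    span-+ (a , int-a , h) (b , int-b , k) = (λ i → a i + b i) , (λ i → int-+ (int-a i) (int-b i)) ,
      trans (+-cong h k) (trans (sym (∑-distrib-+ (λ i → a i * v i) (λ i → b i * v i)))
        (sum-cong-≋ (λ i → sym (distribʳ (v i) (a i) (b i)))))

    span-int-* : ∀ {k x} → Int k → Span x → Span (k * x)
    span-int-* {k} int-k (a , int-a , h) = (λ i → k * a i) , (λ i → int-* int-k (int-a i)) ,
      trans (*-congˡ h) (trans (*-distribˡ-sum k (λ i → a i * v i)) (sum-cong-≋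
          (λ i → sym (*-assoc k (a i) (v i)))))

    span-neg : ∀ {x} → Span x → Span (- x)
    span-neg {x} s = span-≈ (solve 1 (λ x → :- :1 :* x := :- x) refl x) (span-int-* (int-neg int-1) s)

    span-sum : ∀ {k} (f : Fin k → Carrier) → (∀ i → Span (f i)) → Span (sum f)
    span-sum {zero}  f s = span-0
    span-sum {suc k} f s = span-+ (s zero) (span-sum (λ i → f (suc i)) (λ i → s (suc i)))

    -- The multiplier ring of the lattice. If the span contains 1 and is closed under products, as
    -- for the powers of ζ, it is the span itself; in this form closure under products is plain
    -- composition.
    Stabilises : Carrier → Set _
    Stabilises s = ∀ x → Span x → Span (s * x)

    stabilises-generators : ∀ s → (∀ i → Span (s * v i)) → Stabilises s
    stabilises-generators s g x (a , int-a , h) = span-≈ (sym (begin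
      s * x                            ≈⟨ *-congˡ h ⟩
      s * sum (λ i → a i * v i)        ≈⟨ *-distribˡ-sum s (λ i → a i * v i) ⟩
      sum (λ i → s * (a i * v i))      ≈⟨ sum-cong-≋ (λ i → solve 3 (λ s a v → s :* (a :* v)
          := a :* (s :* v)) refl s (a i) (v i)) ⟩
      sum (λ i → a i * (s * v i))      ∎))
      (span-sum (λ i → a i * (s * v i)) (λ i → span-int-* (int-a i) (g i)))

    stabilises-isSubring : IsSubring cring Stabilises
    stabilises-isSubring = record
      { S-+   = λ {s} {t} p q x h → span-≈ (sym (distribʳ x s t)) (span-+ (p x h) (q x h))
      ; S-*   = λ {s} {t} p q x h → span-≈ (sym (*-assoc s t x)) (p (t * x) (q x h))
      ; S-neg = λ {s} p x h → span-≈ (solve 2 (λ s x → :- (s :* x) := (:- s) :* x) refl s x) (span-neg (p x h))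
      ; S-0   = λ x h → span-≈ (sym (zeroˡ x)) span-0
      ; S-1   = λ x h → span-≈ (sym (*-identityˡ x)) h
      }

    open Subring cring Stabilises stabilises-isSubring public using (inclusion) renaming (subring to stabiliser)

    -- If s = 1/2 preserves the lattice, each v i = 2(s v i) is twice an integer combination of
    -- generators. A matrix of the form 1 - 2C has odd determinant, so all generators vanish.
    half-stabilises : (∀ i → Span (v i)) → ∀ s → Stabilises s → 2# * s ≈ 1# → ∀ i → v i ≈ 0#
    half-stabilises gen s st 2s≈1 = elimination v (λ _ → 0#) (λ i → proj₁ (row i)) (λ _ → int-0)
      (λ i → proj₁ (proj₂ (row i)))
      (λ i → trans (lin (- v i) 2s≈1 (solve 2 (λ v s → (:1 :+ :2 :* :0) :* v :+ (:- v) :* :1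
          := :2 :* (s :* v) :+ (:- v) :* (:2 :* s)) refl (v i) s))
        (*-congˡ (proj₂ (proj₂ (row i)))))
      where
      row : ∀ i → Span (s * v i)
      row i = st (v i) (gen i)

    generator : ∀ i → Span (v i)
    generator i = δ i , int-δ i , sym (δ-sum v i)
      where
      δ : ∀ {n} → Fin n → Fin n → Carrier
      δ zero    zero    = 1#
      δ zero    (suc j) = 0#
      δ (suc i) zero    = 0#
      δ (suc i) (suc j) = δ i j
      int-δ : ∀ {n} (i j : Fin n) → Int (δ i j)
      int-δ zero    zero    = int-1
      int-δ zero    (suc j) = int-0
      int-δ (suc i) zero    = int-0
      int-δ (suc i) (suc j) = int-δ i j
      δ-sum : ∀ {n} (w : Fin n → Carrier) i → sum (λ j → δ i j * w j) ≈ w i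
      δ-sum {suc n} w zero    = trans (+-cong (*-identityˡ (w zero))
        (trans (sum-cong-≋ (λ j → zeroˡ (w (suc j)))) (sum-replicate-zero n))) (+-identityʳ (w zero))
      δ-sum {suc n} w (suc i) = trans (+-cong (zeroˡ (w zero)) (δ-sum
          (λ j → w (suc j)) i)) (+-identityˡ (w (suc i)))

⌊⌋-true : ∀ {a} {A : Set a} (d : Dec A) → A → ⌊ d ⌋ ≡ true
⌊⌋-true (yes _) _ = ≡.refl
⌊⌋-true (no ¬a) a = ⊥-elim (¬a a)

⌊⌋-false : ∀ {a} {A : Set a} (d : Dec A) → ¬ A → ⌊ d ⌋ ≡ false
⌊⌋-false (yes a) ¬a = ⊥-elim (¬a a)
⌊⌋-false (no _)  _  = ≡.refl

-- Fractions whose denominators are units modulo g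

-- Residues modulo g of w x for those x ∈ A whose denominators are units modulo g.
module Fractions {c ℓ a ℓ′} (R : CommutativeRing c ℓ) (A : CommutativeRing a ℓ′)
  {ι : CommutativeRing.Carrier R → CommutativeRing.Carrier A}
  (mono : IsRingMonomorphism (CommutativeRing.rawRing R) (CommutativeRing.rawRing A) ι)
  (g w q₀ q₁ : CommutativeRing.Carrier R) where

  private
    module A where
      open CommutativeRing A public
      open RingLemmas A public
  open CommutativeRing R hiding (zero)
  open RingLemmas R
  open IsRingMonomorphism mono using (injective; ⟦⟧-cong; +-homo; *-homo; 0#-homo; 1#-homo)

  -- The fraction n/d equals w x and reduces to e₀q₀ + e₁q₁ modulo g. Keeping only parities of e₀
  -- and e₁ makes the predicate closed under sums with any number of terms.
  HasResidue : A.Carrier → Set _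
  HasResidue x = ∃₂ λ e₀ e₁ → ∃₂ λ d n → Parity e₀ × Parity e₁ × UnitMod g d ×
    ι d A.* (x A.* ι w) A.≈ ι n × ∃ λ t → n ≈ d * (e₀ * q₀ + e₁ * q₁) + g * t

  residue-≈ : ∀ {x y} → x A.≈ y → HasResidue x → HasResidue y
  residue-≈ x≈y (e₀ , e₁ , d , n , p₀ , p₁ , u , h , r) =
    e₀ , e₁ , d , n , p₀ , p₁ , u , A.trans (A.*-congˡ (A.*-congʳ (A.sym x≈y))) h , r

  unit-1 : UnitMod g 1#
  unit-1 = 1# , 0# , solve 1 (λ g → :1 :* :1 := :1 :+ g :* :0) refl g

  residue-0 : HasResidue A.0#
  residue-0 = 0# , 0# , 1# , 0# , parity-0 , parity-0 , unit-1 ,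
    A.trans (A.trans (A.*-congˡ (A.zeroˡ _)) (A.zeroʳ _)) (A.sym 0#-homo) ,
    0# , solve 3 (λ g q₀ q₁ → :0 := :1 :* (:0 :* q₀ :+ :0 :* q₁) :+ g :* :0) refl g q₀ q₁

  residue-+ : ∀ {x y} → HasResidue x → HasResidue y → HasResidue (x A.+ y)
  residue-+ {x} {y} (e₀ , e₁ , d , n , p₀ , p₁ , u , h , s , r) (e₀′ , e₁′ , d′ , n′ , p₀′ , p₁′ , u′ , h′ , s′ , r′) =
    e₀ + e₀′ , e₁ + e₁′ , d * d′ , d′ * n + d * n′ , parity-+ p₀ p₀′ , parity-+ p₁ p₁′ , unit-* u u′ ,
    (A.trans (A.*-congʳ (*-homo d d′)) (A.trans
      (A.lin₂ (ι d′) (ι d) h h′ (A.solve 7 (λ d d′ x y w n n′ →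
        (d A.:* d′) A.:* ((x A.:+ y) A.:* w) A.:+ d′ A.:* n A.:+ d A.:* n′
        A.:= (d′ A.:* n A.:+ d A.:* n′) A.:+ d′ A.:* (d A.:* (x A.:* w)) A.:+ d A.:* (d′ A.:* (y A.:* w)))
        A.refl (ι d) (ι d′) x y (ι w) (ι n) (ι n′)))
      (A.sym (A.trans (+-homo (d′ * n) (d * n′)) (A.+-cong (*-homo d′ n) (*-homo d n′)))))) ,
    d′ * s + d * s′ , trans (+-cong (*-congˡ r) (*-congˡ r′))
      (regroup d d′ e₀ e₁ e₀′ e₁′ s s′)
    where
    regroup : ∀ d d′ e₀ e₁ e₀′ e₁′ s s′ →
      d′ * (d * (e₀ * q₀ + e₁ * q₁) + g * s) + d * (d′ * (e₀′ * q₀ + e₁′ * q₁) + g * s′) ≈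
      d * d′ * ((e₀ + e₀′) * q₀ + (e₁ + e₁′) * q₁) + g * (d′ * s + d * s′)
    regroup d d′ e₀ e₁ e₀′ e₁′ s s′ = solve 11 (λ d d′ e₀ e₁ e₀′ e₁′ s s′ q₀ q₁ g →
      d′ :* (d :* (e₀ :* q₀ :+ e₁ :* q₁) :+ g :* s) :+ d :* (d′ :* (e₀′ :* q₀ :+ e₁′ :* q₁) :+ g :* s′) :=
      d :* d′ :* ((e₀ :+ e₀′) :* q₀ :+ (e₁ :+ e₁′) :* q₁) :+ g :* (d′ :* s :+ d :* s′))
      refl d d′ e₀ e₁ e₀′ e₁′ s s′ q₀ q₁ g

  residue-inverse : ∀ {y D} d n {e₀ e₁ t} → y A.* ι D A.≈ A.1# → d * w ≈ n * D → UnitMod g d →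
    Parity e₀ → Parity e₁ → n ≈ d * (e₀ * q₀ + e₁ * q₁) + g * t → HasResidue y
  residue-inverse {y} {D} d n yD dw u p₀ p₁ r = _ , _ , d , n , p₀ , p₁ , u ,
    A.lin₂ y (ι n) (A.trans (A.sym (*-homo d w)) (A.trans (⟦⟧-cong dw) (*-homo n D))) yD
      (A.solve 5 (λ d y w n D → d A.:* (y A.:* w) A.:+ y A.:* (n A.:* D) A.:+ n A.:* A.:1
        A.:= n A.:+ y A.:* (d A.:* w) A.:+ n A.:* (y A.:* D)) A.refl (ι d) y (ι w) (ι n) (ι D)) ,
    _ , r

  -- For x = 1 injectivity of ι pulls d w = n back to `R`, where the inverse of d modulo g cancels
  -- the denominator.
  residue-1 : HasResidue A.1# →
    ∃₂ λ e₀ e₁ → ∃ λ t → Parity e₀ × Parity e₁ × w ≈ (e₀ * q₀ + e₁ * q₁) + g * t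
  residue-1 (e₀ , e₁ , d , n , p₀ , p₁ , (u , s , du) , h , t , r) =
    e₀ , e₁ , t * u - s * (w - q) , p₀ , p₁ ,
    lin₂ (- (w - q)) u du
      (trans (injective (A.trans (*-homo d w) (A.trans (A.*-congˡ (A.sym (A.*-identityˡ (ι w)))) h))) r)
      (solve 7 (λ d w u s t q g →
        w :+ (:- (w :- q)) :* (:1 :+ g :* s) :+ u :* (d :* q :+ g :* t)
        := (q :+ g :* (t :* u :- s :* (w :- q))) :+ (:- (w :- q)) :* (d :* u) :+ u :* (d :* w)) refl d w u s t q g)
    where q = e₀ * q₀ + e₁ * q₁

-- Eigenvectors of rooted trees of height at most two

module TreeLemmas {c ℓ} (K : Field₀ c ℓ) {n} (T : RootedTree n) (height : HeightAtMost T 2)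
  (μ : Field₀.Carrier K) (x : Fin (suc n) → Field₀.Carrier K) where
  open Field₀ K using (cring; inverse)
  open CommutativeRing cring hiding (zero)
  open RingLemmas cring
  open FieldLemmas K
  open RootedTree T
  open import Relation.Binary.Reasoning.Setoid setoid
  open import Algebra.Properties.Semiring.Sum semiring
    using (sum; sum-cong-≋; *-distribˡ-sum; sum-replicate-zero)

  ∑≡sum : ∀ {k} (f : Fin k → Carrier) → ∑ K f ≡ sum f
  ∑≡sum {zero}  f = ≡.refl
  ∑≡sum {suc k} f = ≡.cong (f zero +_) (∑≡sum (λ i → f (suc i)))

  select : Bool → Carrier → Carrier
  select b y = if b then y else 0#

  select-true : ∀ {b y} → b ≡ true → select b y ≈ y
  select-true ≡.refl = refl

  select-false : ∀ {b y} → b ≡ false → select b y ≈ 0#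
  select-false ≡.refl = refl

  sum-single : ∀ {k} (y : Fin k → Carrier) j → sum (λ i → select ⌊ j ≟ᶠ i ⌋ (y i)) ≈ y j
  sum-single {suc k} y zero    = trans
    (+-congˡ (trans (sum-cong-≋ {k} (λ i → refl)) (sum-replicate-zero k))) (+-identityʳ (y zero))
  sum-single {suc k} y (suc j) = trans (+-identityˡ _)
    (trans (sum-cong-≋ (λ i → suc-select j i)) (sum-single (λ i → y (suc i)) j))
    where
    suc-select : ∀ j i → select ⌊ suc j ≟ᶠ suc i ⌋ (y (suc i)) ≈ select ⌊ j ≟ᶠ i ⌋ (y (suc i))
    suc-select j i with j ≟ᶠ i
    ... | yes _ = refl
    ... | no  _ = refl

  sum-count : ∀ {k} (b : Fin k → Bool) y → ∃ λ a → sum (λ i → select (b i) y) ≈ (a ×ᵣ 1#) * y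
  sum-count {zero}  b y = 0 , sym (zeroˡ y)
  sum-count {suc k} b y with b zero | sum-count (λ i → b (suc i)) y
  ... | true  | a , h = suc a , trans (+-congˡ h) (solve 2 (λ a y → y :+ a :* y := (:1 :+ a) :* y) refl (a ×ᵣ 1#) y)
  ... | false | a , h = a , trans (+-identityˡ _) h

  no-grandchildren : ∀ {i j} → par i ≡ suc j → ∀ k → par k ≢ suc i
  no-grandchildren {i} {j} p k q with ≡.trans (≡.sym p) (≡.trans (≡.cong (TreeOps.parent par) (≡.sym q)) (height (suc k)))
  ... | ()

  child-of-child : ∀ {i j} → par i ≡ suc j → par j ≡ zero
  child-of-child {i} {j} p = ≡.trans (≡.cong (TreeOps.parent par) (≡.sym p)) (height (suc i))

  module Eigenvector (eigen : ∀ u → ∑ K (λ w → if adj T u w then x w else 0#) ≈ μ * x u) where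

    x₀ : Carrier
    x₀ = x zero

    y : Fin n → Carrier
    y i = x (suc i)

    row : Fin (suc n) → Fin (suc n) → Carrier
    row u w = select (adj T u w) (x w)

    root-equation : sum (λ i → select ⌊ par i ≟ᶠ zero ⌋ (y i)) ≈ μ * x₀
    root-equation = trans (trans (sym (+-identityˡ _)) (reflexive (≡.sym (∑≡sum (row zero))))) (eigen zero)

    node-equation : ∀ i → select ⌊ par i ≟ᶠ zero ⌋ x₀ +
      sum (λ k → select (⌊ par i ≟ᶠ suc k ⌋ ∨ ⌊ par k ≟ᶠ suc i ⌋) (y k)) ≈ μ * y i
    node-equation i = trans (reflexive (≡.sym (∑≡sum (row (suc i))))) (eigen (suc i))

    leaf-equation : ∀ {i j} → par i ≡ suc j → μ * y i ≈ y j
    leaf-equation {i} {j} p = begin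
      μ * y i
        ≈⟨ node-equation i ⟨
      select ⌊ par i ≟ᶠ zero ⌋ x₀ + sum (λ k → select (⌊ par i ≟ᶠ suc k ⌋ ∨ ⌊ par k ≟ᶠ suc i ⌋) (y k))
        ≈⟨ +-cong (select-false (⌊⌋-false (par i ≟ᶠ zero) (λ q → 0≢suc (≡.trans (≡.sym q) p)))) (sum-cong-≋ term) ⟩
      0# + sum (λ k → select ⌊ j ≟ᶠ k ⌋ (y k))
        ≈⟨ +-identityˡ _ ⟩
      sum (λ k → select ⌊ j ≟ᶠ k ⌋ (y k))
        ≈⟨ sum-single y j ⟩
      y j ∎
      where
      0≢suc : ∀ {k} {j : Fin k} → _≢_ {A = Fin (suc k)} zero (suc j)
      0≢suc ()
      term : ∀ k → select (⌊ par i ≟ᶠ suc k ⌋ ∨ ⌊ par k ≟ᶠ suc i ⌋) (y k) ≈ select ⌊ j ≟ᶠ k ⌋ (y k)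
      term k rewrite p | ⌊⌋-false (par k ≟ᶠ suc i) (no-grandchildren p k) with j ≟ᶠ k
      ... | yes _ = refl
      ... | no  _ = refl

    -- The equation at a child of the root is multiplied by μ: each of its a leaves then contributes
    -- μ times its value, which is y i by `leaf-equation`. No division by μ occurs.
    child-equation : ∀ {i} → par i ≡ zero → ∃ λ a → (μ * μ - a ×ᵣ 1#) * y i ≈ μ * x₀
    child-equation {i} p = a , lin₂ (- μ) 1# expanded (trans (*-distribˡ-sum μ leaves)
        (trans (sum-cong-≋ pull) (proj₂ counted)))
      (solve 5 (λ m a z r s → (m :* m :- a) :* z :+ (:- m) :* (m :* z) :+ :1 :* (a :* z)
        := m :* r :+ (:- m) :* (r :+ s) :+ :1 :* (m :* s)) refl μ (a ×ᵣ 1#) (y i) x₀ (sum leaves))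
      where
      leaves : Fin n → Carrier
      leaves k = select ⌊ par k ≟ᶠ suc i ⌋ (y k)
      counted = sum-count (λ k → ⌊ par k ≟ᶠ suc i ⌋) (y i)
      a = proj₁ counted
      term : ∀ k → select (⌊ par i ≟ᶠ suc k ⌋ ∨ ⌊ par k ≟ᶠ suc i ⌋) (y k) ≈ leaves k
      term k rewrite p = refl
      expanded : x₀ + sum leaves ≈ μ * y i
      expanded = trans (+-cong (sym (select-true (⌊⌋-true (par i ≟ᶠ zero) p))) (sym (sum-cong-≋ term))) (node-equation i)
      pull : ∀ k → μ * leaves k ≈ select ⌊ par k ≟ᶠ suc i ⌋ (y i)
      pull k with par k ≟ᶠ suc i
      ... | yes q = leaf-equation q
      ... | no  _ = zeroʳ μ

    module _ (x≉0 : ∃ λ u → ¬ (x u ≈ 0#)) (μ≉0 : ¬ (μ ≈ 0#)) (μ²≉ℕ : ∀ a → ¬ (μ * μ - a ×ᵣ 1# ≈ 0#)) where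

      -- A zero at the root spreads to its children, where μ² - a is invertible, and from them to
      -- the leaves, where μ is; then the whole eigenvector would vanish.
      x₀≉0 : ¬ (x₀ ≈ 0#)
      x₀≉0 x₀≈0 = proj₂ x≉0 (vanish (proj₁ x≉0))
        where
        vanish-child : ∀ i → par i ≡ zero → y i ≈ 0#
        vanish-child i p = let (a , h) = child-equation p in
          integral (trans h (trans (*-congˡ x₀≈0) (zeroʳ μ))) (μ²≉ℕ a)
        vanish-node : ∀ i p → par i ≡ p → y i ≈ 0#
        vanish-node i zero    p = vanish-child i p
        vanish-node i (suc j) p = integral (trans (leaf-equation p) (vanish-child j (child-of-child p))) μ≉0
        vanish : ∀ u → x u ≈ 0#
        vanish zero    = x₀≈0
        vanish (suc i) = vanish-node i (par i) ≡.refl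

      -- The eigenvalue equation reads 1 = ∑ 1/(μ² - aᵢ), where the i-th child of the root has aᵢ children.
      1-is-sum-of-inverses : ∀ {p} (P : Carrier → Set p) → (∀ {y z} → y ≈ z → P y → P z) →
        P 0# → (∀ {y z} → P y → P z → P (y + z)) →
        (∀ y a → y * (μ * μ - a ×ᵣ 1#) ≈ 1# → P y) → P 1#
      1-is-sum-of-inverses P P-≈ P-0 P-+ P-inverse = P-≈ s≈1 (proj₁ (proj₂ total))
        where
        summand : ∀ i → ∃ λ z → P z × select ⌊ par i ≟ᶠ zero ⌋ (y i) ≈ (μ * x₀) * z
        summand i with par i ≟ᶠ zero
        ... | no  _ = 0# , P-0 , sym (zeroʳ (μ * x₀))
        ... | yes p = z , P-inverse z a (trans (*-comm z _) (proj₂ inv)) ,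
          lin₂ (- y i) z (proj₂ inv) (proj₂ (child-equation p))
            (solve 4 (λ y z d r → y :+ (:- y) :* :1 :+ z :* r := r :* z :+ (:- y) :* (d :* z) :+ z :* (d :* y))
              refl (y i) z _ (μ * x₀))
          where
          a = proj₁ (child-equation p)
          inv = inverse _ (μ²≉ℕ a)
          z = proj₁ inv
        sum-summands : ∀ {k} (f : Fin k → Carrier) → (∀ i → ∃ λ z → P z × f i ≈ (μ * x₀) * z) →
          ∃ λ z → P z × sum f ≈ (μ * x₀) * z
        sum-summands {zero}  f h = 0# , P-0 , sym (zeroʳ (μ * x₀))
        sum-summands {suc k} f h with h zero | sum-summands (λ i → f (suc i)) (λ i → h (suc i))
        ... | z , pz , e | w , pw , e′ = z + w , P-+ pz pw , trans (+-cong e e′) (sym (distribˡ (μ * x₀) z w))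
        total = sum-summands _ summand
        s = proj₁ total
        s≈1 : s ≈ 1#
        s≈1 = lin 1# (integral {x₀} (integral {μ}
            (lin (- 1#) (trans (sym root-equation) (proj₂ (proj₂ total)))
              (solve 3 (λ m r s → m :* (r :* (s :- :1)) :+ :- :1 :* ((m :* r) :* s)
                  := :0 :+ :- :1 :* (m :* r)) refl μ x₀ s))
            μ≉0) x₀≉0)
          (solve 1 (λ s → s :+ :1 :* :0 := :1 :+ :1 :* (s :- :1)) refl s)

-- The eigenvalue equation modulo 2 and modulo τ³

module Obstructions {c ℓ a ℓ′} (R : CommutativeRing c ℓ) (A : CommutativeRing a ℓ′)
  {ι : CommutativeRing.Carrier R → CommutativeRing.Carrier A}
  (mono : IsRingMonomorphism (CommutativeRing.rawRing R) (CommutativeRing.rawRing A) ι)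
  (domain : DyadicDomain R) where
  private module A = CommutativeRing A
  open CommutativeRing R
  open RingLemmas R
  open DyadicLemmas R domain

  module Ramified {τ s} (τ⁴∣2 : (τ * τ) * (τ * τ) * s ≈ 2#) (nonunit : ∀ x → ¬ (τ * x ≈ 1#)) where
    open Fractions R A mono (τ * τ * τ) τ 1# (- (τ + τ * τ)) public

    -- For e = 2k, factoring τ out of τ - e leaves 1 - kτ³s, as 2 = τ⁴s, so τ/D has residue 1. For
    -- odd e, D is τ - 1 modulo τ³, with inverse -(1 + τ + τ²); multiplying by τ leaves -(τ + τ²).
    residue : ∀ {y D} e → Parity e → D + e ≈ τ → y A.* ι D A.≈ A.1# → HasResidue y
    residue {y} {D} e (k , inj₁ p) D+e yD =
      residue-inverse (1# - k * (τ * τ * τ * s)) 1# {1#} {0#} {k * s} yD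
        (lin₂ (- k) (- 1#) τ⁴∣2 (trans (+-congˡ (sym p)) D+e)
          (solve 4 (λ t s k D → (:1 :- k :* (t :* t :* t :* s)) :* t :+ (:- k) :* :2 :+ :- :1 :* t
            := :1 :* D :+ (:- k) :* ((t :* t) :* (t :* t) :* s) :+ :- :1 :* (D :+ :2 :* k)) refl τ s k D))
        (1# , - (k * s) , solve 3 (λ t s k → (:1 :- k :* (t :* t :* t :* s)) :* :1
            := :1 :+ (t :* t :* t) :* (:- (k :* s))) refl τ s k)
        parity-1 parity-0
        (solve 3 (λ t s k → :1
            := (:1 :- k :* (t :* t :* t :* s)) :* (:1 :* :1 :+ :0 :* (:- (t :+ t :* t)))
                :+ (t :* t :* t) :* (k :* s)) refl τ s k)
    residue {y} {D} e (k , inj₂ p) D+e yD =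
      residue-inverse D τ {0#} {1#} {1# - τ * s * k * (τ + τ * τ)} yD (*-comm D τ)
        (- (1# + τ + τ * τ) , - 1# + τ * s * k * (1# + τ + τ * τ) ,
          lin₂ (- (1# + τ + τ * τ)) (- (k * (1# + τ + τ * τ))) D≈ τ⁴∣2
            (solve 4 (λ t s k D → D :* (:- (:1 :+ t :+ t :* t)) :+ (:- (:1 :+ t :+ t :* t)) :* t
                :+ (:- (k :* (:1 :+ t :+ t :* t))) :* :2
              := (:1 :+ (t :* t :* t) :* (:- :1 :+ t :* s :* k :* (:1 :+ t :+ t :* t)))
                :+ (:- (:1 :+ t :+ t :* t)) :* (D :+ (:1 :+ :2 :* k)) :+ (:- (k :* (:1 :+ t
                    :+ t :* t))) :* ((t :* t) :* (t :* t) :* s)) refl τ s k D))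
        parity-0 parity-1
        (lin₂ (τ + τ * τ) (k * (τ + τ * τ)) D≈ τ⁴∣2
          (solve 4 (λ t s k D → t :+ (t :+ t :* t) :* t :+ (k :* (t :+ t :* t)) :* :2
            := (D :* (:0 :* :1 :+ :1 :* (:- (t :+ t :* t))) :+ (t :* t :* t) :* (:1 :- t :* s :* k :* (t
                :+ t :* t)))
              :+ (t :+ t :* t) :* (D :+ (:1 :+ :2 :* k)) :+ (k :* (t :+ t :* t)) :* ((t :* t) :* (t :* t) :* s))
                  refl τ s k D))
      where
      D≈ : D + (1# + 2# * k) ≈ τ
      D≈ = trans (+-congˡ (sym p)) D+e

    -- The equation τ = e is itself an instance of the impossible congruence, with e₀ = e and e₁ =
    -- 0.
    τ-not-integer : ∀ e → Parity e → ¬ (e ≈ τ)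
    τ-not-integer e p e≈τ = ramified-fractions {t = 0#} τ⁴∣2 nonunit p parity-0 (trans (sym e≈τ)
      (solve 2 (λ e t → e := (e :* :1 :+ :0 :* (:- (t :+ t :* t))) :+ t :* t :* t :* :0) refl e τ))

    contradictory : ¬ HasResidue A.1#
    contradictory h = let (e₀ , e₁ , t , p₀ , p₁ , e) = residue-1 h in ramified-fractions τ⁴∣2 nonunit p₀ p₁ e

  module Unramified {θ} (θ-unit : UnitMod 2# θ) (θ-1-unit : UnitMod 2# (θ - 1#)) where
    private
      u = proj₁ θ-unit
      v = proj₁ θ-1-unit
    open Fractions R A mono 2# 1# u v public

    -- Modulo 2 the denominator is θ or θ - 1 according to the parity of e, so its inverse is `u` or
    -- `v`.
    residue : ∀ {y D} e → Parity e → D + e ≈ θ → y A.* ι D A.≈ A.1# → HasResidue y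
    residue {y} {D} e (k , inj₁ p) D+e yD =
      residue-inverse D 1# {1#} {0#} {k * u - proj₁ (proj₂ θ-unit)} yD (*-comm D 1#)
        (unit-shift (- k) (lin 1# D≈ (solve 3 (λ D t k → D :+ :1 :* t
            := (t :+ :2 :* (:- k)) :+ :1 :* (D :+ :2 :* k)) refl D θ k)) θ-unit)
        parity-1 parity-0
        (lin₂ (- u) (- 1#) D≈ (proj₂ (proj₂ θ-unit))
          (solve 6 (λ D t k u a v → :1 :+ (:- u) :* t :+ :- :1 :* (:1 :+ :2 :* a)
            := (D :* (:1 :* u :+ :0 :* v) :+ :2 :* (k :* u :- a)) :+ (:- u) :* (D :+ :2 :* k) :+ :- :1 :* (t :* u))
            refl D θ k u (proj₁ (proj₂ θ-unit)) v))
      where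
      D≈ : D + 2# * k ≈ θ
      D≈ = trans (+-congˡ (sym p)) D+e
    residue {y} {D} e (k , inj₂ p) D+e yD =
      residue-inverse D 1# {0#} {1#} {k * v - proj₁ (proj₂ θ-1-unit)} yD (*-comm D 1#)
        (unit-shift (- k) (lin 1# D≈ (solve 3 (λ D t k → D :+ :1 :* t
            := ((t :- :1) :+ :2 :* (:- k)) :+ :1 :* (D :+ (:1 :+ :2 :* k))) refl D θ k)) θ-1-unit)
        parity-0 parity-1
        (lin₂ (- v) (- 1#) D≈ (proj₂ (proj₂ θ-1-unit))
          (solve 6 (λ D t k v a u → :1 :+ (:- v) :* t :+ :- :1 :* (:1 :+ :2 :* a)
            := (D :* (:0 :* u :+ :1 :* v) :+ :2 :* (k :* v :- a)) :+ (:- v) :* (D :+ (:1 :+ :2 :* k))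
                :+ :- :1 :* ((t :- :1) :* v))
            refl D θ k v (proj₁ (proj₂ θ-1-unit)) u))
      where
      D≈ : D + (1# + 2# * k) ≈ θ
      D≈ = trans (+-congˡ (sym p)) D+e

    θ-not-integer : ∀ e → Parity e → ¬ (e ≈ θ)
    θ-not-integer e (k , inj₁ p) e≈θ = 0-nonunit (unit-shift (- k)
      (lin₂ (- 1#) (- 1#) p (sym e≈θ) (solve 3 (λ e k t → :0 :+ :- :1 :* (:2 :* k) :+ :- :1 :* e
        := (t :+ :2 :* (:- k)) :+ :- :1 :* e :+ :- :1 :* t) refl e k θ)) θ-unit)
    θ-not-integer e (k , inj₂ p) e≈θ = 0-nonunit (unit-shift (- k)
      (lin₂ (- 1#) (- 1#) p (sym e≈θ) (solve 3 (λ e k t → :0 :+ :- :1 :* (:1 :+ :2 :* k) :+ :- :1 :* e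
        := ((t :- :1) :+ :2 :* (:- k)) :+ :- :1 :* e :+ :- :1 :* t) refl e k θ)) θ-1-unit)

    quadratic : HasResidue A.1# → ∃ λ r → θ * θ + θ + 1# ≈ 2# * r
    quadratic h = let (e₀ , e₁ , t , p₀ , p₁ , e) = residue-1 h in unramified-fractions θ-unit θ-1-unit p₀ p₁ e

module TreeObstructions {c ℓ a ℓ′} (K : Field₀ c ℓ)
  {n} (T : RootedTree n) (height : HeightAtMost T 2) (μ : Field₀.Carrier K) (eigenvalue : IsEigenvalue K T μ)
  (R : CommutativeRing a ℓ′) {ι : CommutativeRing.Carrier R → Field₀.Carrier K}
  (mono : IsRingMonomorphism (CommutativeRing.rawRing R) (CommutativeRing.rawRing (Field₀.cring K)) ι)
  (domain : DyadicDomain R)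
  (θ : CommutativeRing.Carrier R) (μ²≈θ : Field₀._≈_ K (Field₀._*_ K μ μ) (ι θ)) where

  open CommutativeRing R
  open RingLemmas R
  open Field₀ K using () renaming (cring to A)
  private
    module A where
      open CommutativeRing A public
      open RingLemmas A public
  open IsRingMonomorphism mono using (injective; +-homo; -‿homo; 0#-homo; 1#-homo)

  ×-ι : ∀ n → ι (n ×ᵣ 1#) A.≈ n A.×ᵣ A.1#
  ×-ι zero    = 0#-homo
  ×-ι (suc n) = A.trans (+-homo 1# (n ×ᵣ 1#)) (A.+-cong 1#-homo (×-ι n))

  μ²-k : ∀ k → ι (θ - k ×ᵣ 1#) A.≈ μ A.* μ A.- k A.×ᵣ A.1#
  μ²-k k = A.trans (+-homo θ (- (k ×ᵣ 1#)))
    (A.+-cong (A.sym μ²≈θ) (A.trans (-‿homo (k ×ᵣ 1#)) (A.-‿cong (×-ι k))))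

  1-is-sum-of-inverses : ∀ {p} (P : A.Carrier → Set p) → (∀ {y z} → y A.≈ z → P y → P z) →
    P A.0# → (∀ {y z} → P y → P z → P (y A.+ z)) →
    (∀ k → ¬ (k ×ᵣ 1# ≈ θ)) → (∀ {y} k → y A.* ι (θ - k ×ᵣ 1#) A.≈ A.1# → P y) → P A.1#
  1-is-sum-of-inverses P P-≈ P-0 P-+ θ≉ℕ P-inverse =
    TreeLemmas.Eigenvector.1-is-sum-of-inverses K T height μ (proj₁ eigenvalue) (proj₂ (proj₂ eigenvalue))
      (proj₁ (proj₂ eigenvalue)) μ≉0 μ²≉ℕ P P-≈ P-0 P-+ (λ y k e → P-inverse k (A.trans (A.*-congˡ (μ²-k k)) e))
    where
    μ²≉ℕ : ∀ k → ¬ (μ A.* μ A.- k A.×ᵣ A.1# A.≈ A.0#)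
    μ²≉ℕ k h = θ≉ℕ k (lin (- 1#) (injective (A.trans (μ²-k k) (A.trans h (A.sym 0#-homo))))
      (solve 2 (λ a t → a :+ :- :1 :* :0 := t :+ :- :1 :* (t :- a)) refl (k ×ᵣ 1#) θ))
    μ≉0 : ¬ (μ A.≈ A.0#)
    μ≉0 h = μ²≉ℕ 0 (A.lin μ h (A.solve 1 (λ l → (l A.:* l A.:- A.:0) A.:+ l A.:* A.:0
      A.:= A.:0 A.:+ l A.:* l) A.refl μ))

  unramified-quadratic : UnitMod 2# θ → UnitMod 2# (θ - 1#) → ∃ λ r → θ * θ + θ + 1# ≈ 2# * r
  unramified-quadratic θ-unit θ-1-unit = quadratic
    (1-is-sum-of-inverses HasResidue residue-≈ residue-0 residue-+
      (λ k → θ-not-integer (k ×ᵣ 1#) (parity-× k))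
      (λ k → residue (k ×ᵣ 1#) (parity-× k)
        (solve 2 (λ a t → t :- a :+ a := t) refl (k ×ᵣ 1#) θ)))
    where open Obstructions.Unramified R A mono domain θ-unit θ-1-unit

  ramified-absurd : ∀ {τ s} → (τ * τ) * (τ * τ) * s ≈ 2# → (∀ x → ¬ (τ * x ≈ 1#)) → ¬ (τ ≈ θ ⊎ 1# + τ ≈ θ)
  ramified-absurd {τ} τ⁴∣2 nonunit shift = contradictory
    (1-is-sum-of-inverses HasResidue residue-≈ residue-0 residue-+
      (λ k h → τ-not-integer (offset k) (offset-parity k) (lin₂ 1# 1# (offset-≈ k) h
        (solve 4 (λ a t s e → e :+ :1 :* s :+ :1 :* t := s :+ :1 :* ((t :- a) :+ e) :+ :1 :* a)
          refl (k ×ᵣ 1#) θ τ (offset k))))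
      (λ k → residue (offset k) (offset-parity k) (offset-≈ k)))
    where
    open Obstructions.Ramified R A mono domain τ⁴∣2 nonunit
    -- The denominator θ - k is τ - e with e = k or e = k - 1; the shift by one exchanges the roles
    -- of even and odd k.
    shifted : (τ ≈ θ ⊎ 1# + τ ≈ θ) → ∀ k → ∃ λ e → Parity e × (θ - k ×ᵣ 1#) + e ≈ τ
    shifted (inj₁ h) k = k ×ᵣ 1# , parity-× k ,
      trans (solve 2 (λ a t → t :- a :+ a := t) refl (k ×ᵣ 1#) θ) (sym h)
    shifted (inj₂ h) k = k ×ᵣ 1# - 1# ,
      parity-+ (parity-× k) (- 1# , inj₂ (solve 0 (:- :1 := :1 :+ :2 :* (:- :1)) refl)) ,
      lin (- 1#) h (solve 3 (λ a t s → (t :- a) :+ (a :- :1) :+ :- :1 :* t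
        := s :+ :- :1 :* (:1 :+ s)) refl (k ×ᵣ 1#) θ τ)
    offset : ℕ → Carrier
    offset k = proj₁ (shifted shift k)
    offset-parity : ∀ k → Parity (offset k)
    offset-parity k = proj₁ (proj₂ (shifted shift k))
    offset-≈ : ∀ k → (θ - k ×ᵣ 1#) + offset k ≈ τ
    offset-≈ k = proj₂ (proj₂ (shifted shift k))

module Conclusion {c ℓ a ℓ′} (K : Field₀ c ℓ)
  {n} (T : RootedTree n) (height : HeightAtMost T 2) (μ : Field₀.Carrier K) (eigenvalue : IsEigenvalue K T μ)
  (R : CommutativeRing a ℓ′) {ι : CommutativeRing.Carrier R → Field₀.Carrier K}
  (mono : IsRingMonomorphism (CommutativeRing.rawRing R) (CommutativeRing.rawRing (Field₀.cring K)) ι)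
  (domain : DyadicDomain R) (m : ℕ) (m≥1 : m ≥ 1) (root : RootOfUnity R m)
  (μ≈ : Field₀._≈_ K μ (ι (CommutativeRing._+_ R (RootOfUnity.ζ root) (RootOfUnity.ζ⁻¹ root)))) where

  open Classification R domain m root

  μ²≈θ : Field₀._≈_ K (Field₀._*_ K μ μ) (ι θ)
  μ²≈θ = Field₀.trans K (Field₀.*-cong K μ≈ μ≈) (Field₀.sym K (IsRingMonomorphism.*-homo mono _ _))

  open TreeObstructions K T height μ eigenvalue R mono domain θ μ²≈θ

  m∈allowed : m ∈ allowed
  m∈allowed with classify m≥1
  ... | inj₁ m∈ = m∈
  ... | inj₂ (inj₁ (τ , s , τ⁴∣2 , nonunit , shift)) = ⊥-elim (ramified-absurd τ⁴∣2 nonunit shift)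
  ... | inj₂ (inj₂ (θ-unit , θ-1-unit , quadratic⇒∣20)) = ∣20⇒allowed (quadratic⇒∣20 (unramified-quadratic θ-unit θ-1-unit))

-- The ring ℤ[ζ] inside the given field

module Cyclotomic {c ℓ} (K : Field₀ c ℓ) (m : ℕ) (ζ : Field₀.Carrier K) (m≥1 : m ≥ 1) (prim : PrimitiveRoot K m ζ) where
  open Field₀ K using (cring; 1≉0)
  private
    module K where
      open CommutativeRing cring public
      open RingLemmas cring public
      open FieldLemmas K public
  open K using (_≈_; _*_)
  instance
    m≢0 : ℕ.NonZero m
    m≢0 = ℕ.>-nonZero m≥1

  pow≡ : ∀ x k → Field₀._^_ K x k ≡ x K.^ k
  pow≡ x zero    = ≡.refl
  pow≡ x (suc k) = ≡.cong (x *_) (pow≡ x k)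

  ζ^m : ζ K.^ m ≈ K.1#
  ζ^m = K.trans (K.reflexive (≡.sym (pow≡ ζ m))) (proj₁ prim)

  1^ : ∀ k → K.1# K.^ k ≈ K.1#
  1^ zero    = K.refl
  1^ (suc k) = K.trans (K.*-identityˡ _) (1^ k)

  ζ^% : ∀ k → ζ K.^ k ≈ ζ K.^ (k % m)
  ζ^% k = begin
    ζ K.^ k                                 ≡⟨ ≡.cong (ζ K.^_) (m≡m%n+[m/n]*n k m) ⟩
    ζ K.^ (k % m ℕ.+ k / m ℕ.* m)           ≈⟨ K.^-homo-* ζ (k % m) (k / m ℕ.* m) ⟩
    ζ K.^ (k % m) * ζ K.^ (k / m ℕ.* m)     ≡⟨ ≡.cong (λ n → ζ K.^ (k % m) * ζ K.^ n) (ℕₚ.*-comm (k / m) m) ⟩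
    ζ K.^ (k % m) * ζ K.^ (m ℕ.* (k / m))   ≈⟨ K.*-congˡ (K.sym (K.^-assocʳ ζ m (k / m))) ⟩
    ζ K.^ (k % m) * (ζ K.^ m) K.^ (k / m)   ≈⟨ K.*-congˡ (K.trans (K.^-congˡ (k / m) ζ^m) (1^ (k / m))) ⟩
    ζ K.^ (k % m) * K.1#                    ≈⟨ K.*-identityʳ _ ⟩
    ζ K.^ (k % m)                           ∎
    where open import Relation.Binary.Reasoning.Setoid K.setoid

  ^≈1⇒∣ : ∀ k → ζ K.^ k ≈ K.1# → m ∣ k
  ^≈1⇒∣ k h = m%n≡0⇒n∣m k m (remainder-0 (k % m) (m%n<n k m) (K.trans (K.sym (ζ^% k)) h))
    where
    remainder-0 : ∀ r → r < m → ζ K.^ r ≈ K.1# → r ≡ 0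
    remainder-0 zero    _   _ = ≡.refl
    remainder-0 (suc r) r<m e = ⊥-elim (proj₂ prim (suc r) (s≤s z≤n) r<m (K.trans (K.reflexive (pow≡ ζ (suc r))) e))

  ∣⇒^≈1 : ∀ {k} → m ∣ k → ζ K.^ k ≈ K.1#
  ∣⇒^≈1 (divides q ≡.refl) = K.trans (K.reflexive (≡.cong (ζ K.^_) (ℕₚ.*-comm q m)))
    (K.trans (K.sym (K.^-assocʳ ζ m q)) (K.trans (K.^-congˡ q ζ^m) (1^ q)))

  powers : Fin m → K.Carrier
  powers i = ζ K.^ toℕ i

  open K.Span powers

  -- ℤ[ζ], realised as the elements of K that stabilise the ℤ-span of 1, ζ, …, ζᵐ⁻¹.
  R : CommutativeRing _ _
  R = stabiliser

  module R where
    open CommutativeRing R public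
    open RingLemmas R public

  power-in-span : ∀ k → Span (ζ K.^ k)
  power-in-span k = span-≈ (K.trans (K.reflexive (≡.cong (ζ K.^_) (toℕ-fromℕ< (m%n<n k m)))) (K.sym (ζ^% k)))
    (generator (fromℕ< (m%n<n k m)))

  ζᴿ : R.Carrier
  ζᴿ = ζ , stabilises-generators ζ (λ i → power-in-span (suc (toℕ i)))

  pow-ι : ∀ k → proj₁ (ζᴿ R.^ k) ≡ ζ K.^ k
  pow-ι zero    = ≡.refl
  pow-ι (suc k) = ≡.cong (ζ *_) (pow-ι k)

  ζ⁻¹ᴿ : R.Carrier
  ζ⁻¹ᴿ = ζᴿ R.^ (m ℕ.∸ 1)

  ζζ⁻¹ : ζᴿ R.* ζ⁻¹ᴿ R.≈ R.1#
  ζζ⁻¹ = K.trans (K.reflexive (≡.trans (pow-ι (suc (m ℕ.∸ 1))) (≡.cong (ζ K.^_) (ℕₚ.m+[n∸m]≡n m≥1)))) ζ^m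

  -- A half in the stabiliser would make every generator vanish; the generator with exponent 0,
  -- present because m ≥ 1, is 1.
  2∤1 : ∀ x → ¬ (R.2# R.* x R.≈ R.1#)
  2∤1 (s , st) h = 1≉0 (K.trans (K.reflexive (≡.cong (ζ K.^_) (≡.sym (toℕ-fromℕ< m≥1))))
    (half-stabilises generator s st h (fromℕ< m≥1)))

  domain : DyadicDomain R
  domain = record { integral = λ {x} {y} → K.integral {proj₁ x} {proj₁ y} ; 2≉0 = K.2≉0 ; 2∤1 = 2∤1 }

  root : RootOfUnity R m
  root = record
    { ζ     = ζᴿ
    ; ζ⁻¹   = ζ⁻¹ᴿ
    ; ζζ⁻¹  = ζζ⁻¹
    ; ^≈1⇒∣ = λ k h → ^≈1⇒∣ k (K.trans (K.reflexive (≡.sym (pow-ι k))) h)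
    ; ∣⇒^≈1 = λ {k} d → K.trans (K.reflexive (pow-ι k)) (∣⇒^≈1 d)
    }

  realCyc≡ : realCyc K m ζ ≡ ζ K.+ proj₁ ζ⁻¹ᴿ
  realCyc≡ = ≡.cong (ζ K.+_) (≡.trans (pow≡ ζ (m ℕ.∸ 1)) (≡.sym (pow-ι (m ℕ.∸ 1))))

  m∈allowed : ∀ {n} (T : RootedTree n) → HeightAtMost T 2 → IsEigenvalue K T (realCyc K m ζ) → m ∈ allowed
  m∈allowed T height eigenvalue = Conclusion.m∈allowed K T height (realCyc K m ζ) eigenvalue
    R inclusion domain m m≥1 root (K.reflexive realCyc≡)

theorem3 : ∀ {c ℓ : Level} (K : Field₀ c ℓ) (m : ℕ) (ζ : Field₀.Carrier K) →
    m ≥ 1 → PrimitiveRoot K m ζ →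
    Σ ℕ (λ n → Σ (RootedTree n) (λ T → HeightAtMost T 2 × IsEigenvalue K T (realCyc K m ζ))) →
    m ∈ allowed
theorem3 K m ζ m≥1 prim (n , T , height , eigenvalue) = Cyclotomic.m∈allowed K m ζ m≥1 prim T height eigenvalue
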